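{- Let $G$ be a finite connected graph. Then $\chi_{DP}^\ast(G) \leq 2$ if and only if $G$ contains no odd cycles and at most one even cycle. Furthermore, if $G$ contains no odd cycles and exactly one even cycle, then $\chi_{DP}^\ast(G) = 2$, while $\theta_{DP}(G,k)^{ -1} > 2$ for every positive integer $k$ (i.e., the infimum defining $\chi_{DP}^\ast(G)$ is not attained).
   Context: All graphs are finite, without loops or multiple edges. A cover of a graph $G$ is a pair $(L,H)$ where $H$ is a graph and $L\colon V(G)\to 2^{V(H)}$ satisfies: the sets $L(u)$, $u\in V(G)$, partition $V(H)$; each $H[L(u)]$ is complete; if there is an edge of $H$ between $L(u)$ and $L(v)$ with $u\neq v$ then $uv\in E(G)$; and for each $uv\in E(G)$ the edges of $H$ between $L(u)$ and $L(v)$ form a (not necessarily perfect, possibly empty) matching. The cover is $k$-fold if $|L(u)|=k$ for all $u$. Edges of $H$ joining different sets $L(u)\ne L(v)$ are cross-edges; $S\subseteq V(H)$ is quasi-independent if it spans no cross-edges. For $\eta\in[0,1]$, an $(\eta,(L,H))$-coloring of $G$ is a quasi-independent $S\subseteq V(H)$ with $|S\cap L(u)|\geq \eta|L(u)|$ for all $u\in V(G)$. For $k\in\mathbb{N}^+$, $\theta_{DP}(G,k)$ is the maximum $\eta\in[0,1]$ such that $G$ admits an $(\eta,\mathcal{H})$-coloring for every $k$-fold cover $\mathcal{H}$ of $G$, and the fractional DP-chromatic number is $\chi_{DP}^\ast(G)=\inf\{\theta_{DP}(G,k)^{ -1}: k\in\mathbb{N}^+\}$. -}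

module Defs where

open import Data.Nat as ℕ using (ℕ; zero; suc; NonZero)
open import Data.Nat.Divisibility using (_∣_)
open import Data.Fin using (Fin; zero; suc; inject₁; fromℕ)
open import Data.Fin.Subset using (Subset; _∈_; ∣_∣)
open import Data.Bool using (Bool; true; false)
open import Data.Integer using (+_)
open import Data.Rational using (ℚ; _≤_; _<_; _*_; _+_; 0ℚ; 1ℚ; ½)
open import Data.Product using (Σ; ∃; _×_; _,_)
open import Data.Sum using (_⊎_)
open import Data.Empty using (⊥)
open import Relation.Nullary using (¬_)
open import Relation.Binary.PropositionalEquality using (_≡_)
open import Function.Definitions using (Injective)

record Graph : Set where
  field
    n      : ℕ
    adj    : Fin n → Fin n → Bool
    sym    : ∀ u v → adj u v ≡ adj v u
    irrefl : ∀ u → adj u u ≡ false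
open Graph public

ℕ→ℚ : ℕ → ℚ
ℕ→ℚ m = (+ m) Data.Rational./ 1

data Walk (G : Graph) : Fin (n G) → Fin (n G) → Set where
  here : ∀ {u} → Walk G u u
  step : ∀ {u w v} → adj G u w ≡ true → Walk G w v → Walk G u v

Connected : Graph → Set
Connected G = NonZero (n G) × (∀ u v → Walk G u v)

record Cycle (G : Graph) : Set where
  field
    m'      : ℕ
    long    : 2 ℕ.≤ m'
    vs      : Fin (suc m') → Fin (n G)
    inj     : Injective _≡_ _≡_ vs
    path    : ∀ (i : Fin m') → adj G (vs (inject₁ i)) (vs (suc i)) ≡ true
    closing : adj G (vs (fromℕ m')) (vs zero) ≡ true
open Cycle public

cycLength : ∀ {G} → Cycle G → ℕ
cycLength c = suc (m' c)

EvenCycle OddCycle : ∀ {G} → Cycle G → Set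
EvenCycle c = 2 ∣ cycLength c
OddCycle c = ¬ (2 ∣ cycLength c)

CycEdge : ∀ {G} → Cycle G → Fin (n G) → Fin (n G) → Set
CycEdge c u v =
  (∃ λ (i : Fin (m' c)) →
      ((vs c (inject₁ i) ≡ u) × (vs c (suc i) ≡ v))
    ⊎ ((vs c (inject₁ i) ≡ v) × (vs c (suc i) ≡ u)))
  ⊎ (((vs c (fromℕ (m' c)) ≡ u) × (vs c zero ≡ v))
    ⊎ ((vs c (fromℕ (m' c)) ≡ v) × (vs c zero ≡ u)))

SameCycle : ∀ {G} → Cycle G → Cycle G → Set
SameCycle c d = ∀ u v → (CycEdge c u v → CycEdge d u v) × (CycEdge d u v → CycEdge c u v)

NoOddCycle : Graph → Set
NoOddCycle G = (c : Cycle G) → ¬ OddCycle c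

AtMostOneEvenCycle : Graph → Set
AtMostOneEvenCycle G = (c d : Cycle G) → EvenCycle c → EvenCycle d → SameCycle c d

ExactlyOneEvenCycle : Graph → Set
ExactlyOneEvenCycle G = (Σ (Cycle G) EvenCycle) × AtMostOneEvenCycle G

-- k-fold covers.  Up to isomorphism, V(H) = V(G) × Fin k with
-- L(u) = {u} × Fin k; each H[L(u)] is complete (implicit), and the
-- cross-edges are given by  cross u v i j  (edge between (u,i) and (v,j)).

record Cover (G : Graph) (k : ℕ) : Set where
  field
    cross    : Fin (n G) → Fin (n G) → Fin k → Fin k → Bool
    crossSym : ∀ u v i j → cross u v i j ≡ cross v u j i
    crossAdj : ∀ u v i j → cross u v i j ≡ true → adj G u v ≡ true
    matchingˡ : ∀ u v i j j' → cross u v i j ≡ true → cross u v i j' ≡ true → j ≡ j'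
    matchingʳ : ∀ u v i i' j → cross u v i j ≡ true → cross u v i' j ≡ true → i ≡ i'
open Cover public

-- S ⊆ V(H) given by its traces S u ⊆ L(u)
QuasiIndependent : ∀ {G k} → Cover G k → (Fin (n G) → Subset k) → Set
QuasiIndependent H S = ∀ u v i j → cross H u v i j ≡ true → i ∈ S u → j ∈ S v → ⊥

Coloring : ∀ {G k} → ℚ → Cover G k → Set
Coloring {G} {k} η H = Σ (Fin (n G) → Subset k) λ S →
  QuasiIndependent H S × (∀ u → η * ℕ→ℚ k ≤ ℕ→ℚ ∣ S u ∣)

AdmitsAll : Graph → ℕ → ℚ → Set
AdmitsAll G k η = (H : Cover G k) → Coloring η H

IsThetaDP : Graph → ℕ → ℚ → Set
IsThetaDP G k θ =
  (0ℚ ≤ θ) × (θ ≤ 1ℚ) × AdmitsAll G k θ ×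
  (∀ η → 0ℚ ≤ η → η ≤ 1ℚ → AdmitsAll G k η → η ≤ θ)

-- χ*_DP(G) = inf { θ_DP(G,k)⁻¹ : k ≥ 1 }  (with 0⁻¹ = ∞)
-- χ*_DP(G) ≤ r :  ∀ ε > 0, ∃ k ≥ 1 with θ_DP(G,k)⁻¹ < r + ε
ChiDP≤ : Graph → ℚ → Set
ChiDP≤ G r = ∀ (ε : ℚ) → 0ℚ < ε →
  Σ ℕ λ k → NonZero k × Σ ℚ λ θ → IsThetaDP G k θ × 0ℚ < θ × 1ℚ < (r + ε) * θ

-- χ*_DP(G) ≥ r :  ∀ k ≥ 1, θ_DP(G,k)⁻¹ ≥ r   (i.e. r θ ≤ 1)
ChiDP≥ : Graph → ℚ → Set
ChiDP≥ G r = ∀ (k : ℕ) → NonZero k → ∀ θ → IsThetaDP G k θ → r * θ ≤ 1ℚ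

-- θ_DP(G,k)⁻¹ > r   (i.e. r θ < 1, including θ = 0)
ThetaInv> : Graph → ℕ → ℚ → Set
ThetaInv> G k r = ∀ θ → IsThetaDP G k θ → r * θ < 1ℚ

two : ℚ
two = ℕ→ℚ 2

{-# OPTIONS --safe #-}
module Submission where

-- Lower bounds on χ*.  Labelling the edges of G by permutations gives covers.  If all the sets S u have size
-- about k/2, then the sets at the ends of an edge labelled by the identity are nearly complementary, so a
-- closed odd walk of such edges is impossible.  If a connected spanning subgraph labelled by the identity leaves
-- out two edges, labelled by σ and τ and closed up by odd walks, then S x is nearly invariant under both
-- σ and τ.  Taking σ a k-cycle, a set nearly invariant under σ has few changes along the cycle, so there are few
-- such sets, and counting shows that some τ moves each of them substantially.  For a single cycle, σ alone
-- excludes exact halves, since only the empty and the full set are invariant under it.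
--
-- Upper bound on χ*.  For k = 2j + 1, trivialise a given cover along a spanning tree.  The only remaining edge joins
-- the two sides of the bipartition and carries a partial matching ρ.  Choose A with |A| = j and A ∪ ρ(A) ⊆ U,
-- |U| ≤ j + 1, and use A on one side and the complement of U on the other.

open import Defs renaming (n to order; sym to adj-sym)
open import Data.Bool using (Bool; true; false; not; if_then_else_; _∧_)
import Data.Bool.Properties as B
open import Data.Empty using (⊥)
open import Data.Fin as F using (Fin; zero; suc; inject₁; fromℕ; toℕ; punchIn; punchOut; opposite)
open import Data.Fin.Permutation as P using (Permutation′; _⟨$⟩ʳ_; _⟨$⟩ˡ_; insert; permutation; _∘ₚ_)
import Data.Fin.Properties as F
open import Data.Fin.Subset using (Subset; ∣_∣; ⊤)
open import Data.Nat.Divisibility using (_∣_; _∣?_; divides; ∣⇒≤; ∣m+n∣m⇒∣n; ∣-refl; _∣0; ∣m∣n⇒∣m+n)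
open import Data.Nat using (ℕ; zero; suc; NonZero)
open import Data.Product using (Σ; ∃; _×_; _,_; proj₁; proj₂)
open import Data.Sum as Sum using (_⊎_; inj₁; inj₂; [_,_]′)
open import Data.Vec using (Vec; []; _∷_; lookup; tabulate; _[_]=_)
open import Data.Vec.Properties using (lookup⇒[]=; []=⇒lookup; lookup∘tabulate)
open import Function using (_∘_; id; mk⇔)
open import Function.Bundles using (_⇔_)
open import Function.Definitions using (Injective)
open import Relation.Binary.PropositionalEquality
open import Relation.Nullary
open import Relation.Nullary.Decidable using (decidable-stable; does-⇔)

-- Excluding exact halves is not enough to push the infimum above 2, because halves might still be
-- approached. What is needed is a bound `k ≤ L * δ`, with `L` depending on the graph alone, on the
-- deficiency `δ` of every colouring. A rotation alone cannot give this: a block of consecutive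
-- points is moved at only two places, however large k is. This is why one even cycle leaves the
-- infimum at 2, while two different cycles need a second permutation. The permutation τ has to be
-- fixed before the colouring is known, so it must work for all balanced sets at once. Rather than
-- counting nearly invariant sets for each tolerance, every set receives the weight `q` to the
-- number of its agreements with its two images. Summed over all τ and all balanced sets, these
-- weights are small on average, and a τ at or below the average bounds each set separately. The
-- gain comes from binomial coefficients, the loss from the factor (1 + 1/q) at each position.

module Mixing where

  open import Data.Nat
  open import Data.Nat.Properties
  open import Data.Nat.Combinatorics using ([n∸k]!k!∣n!)
  open import Data.Nat.Solver using (module +-*-Solver)
  open import Algebra.Properties.CommutativeMonoid.Sum +-0-commutativeMonoid
  open import Data.Unit using (tt)

  private variable n : ℕ

  -- Sums over finite sets, permutations and two-colourings

  sum-mono-≤ : {f g : Fin n → ℕ} → (∀ i → f i ≤ g i) → sum f ≤ sum g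
  sum-mono-≤ {zero}  h = z≤n
  sum-mono-≤ {suc n} h = +-mono-≤ (h zero) (sum-mono-≤ (h ∘ suc))

  sum-*ʳ : (f : Fin n → ℕ) (c : ℕ) → sum (λ i → f i * c) ≡ sum f * c
  sum-*ʳ {zero}  f c = refl
  sum-*ʳ {suc n} f c = trans (cong (f zero * c +_) (sum-*ʳ (f ∘ suc) c)) (sym (*-distribʳ-+ c (f zero) _))

  sum-const : ∀ n c → sum {n} (λ _ → c) ≡ n * c
  sum-const zero    c = refl
  sum-const (suc n) c = cong (c +_) (sum-const n c)

  sum<⇒∃< : (f : Fin n → ℕ) (W : ℕ) → sum f < n * W → ∃ λ i → f i < W
  sum<⇒∃< {suc n} f W h with f zero <? W
  ... | yes p = zero , p
  ... | no ¬p with sum<⇒∃< (f ∘ suc) W (+-cancelˡ-< W _ _ (≤-<-trans (+-monoˡ-≤ _ (≮⇒≥ ¬p)) h))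
  ...   | i , q = suc i , q

  χ : Bool → ℕ
  χ b = if b then 1 else 0

  size : (Fin n → Bool) → ℕ
  size A = sum (χ ∘ A)

  agree : Bool → Bool → ℕ
  agree a b = χ (if a then b else not b)

  agreements : (A B : Fin n → Bool) → ℕ
  agreements A B = sum λ i → agree (A i) (B i)

  χ+χ-not : ∀ b → χ b + χ (not b) ≡ 1
  χ+χ-not true  = refl
  χ+χ-not false = refl

  size+size-not : (A : Fin n → Bool) → size A + size (not ∘ A) ≡ n
  size+size-not {n} A = trans (sym (∑-distrib-+ (χ ∘ A) (χ ∘ not ∘ A)))
    (trans (sum-cong-≗ (χ+χ-not ∘ A)) (trans (sum-const n 1) (*-identityʳ n)))

  -- Inserting the image `j` of `zero` into a permutation of the remaining points runs through all
  -- permutations. The averaging argument rests on the number of terms, which is n!.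
  ∑perm : ∀ n → (Permutation′ n → ℕ) → ℕ
  ∑perm zero    f = f P.id
  ∑perm (suc n) f = sum λ j → ∑perm n λ π → f (insert zero j π)

  ∑perm-cong : ∀ n {f g : Permutation′ n → ℕ} → (∀ π → f π ≡ g π) → ∑perm n f ≡ ∑perm n g
  ∑perm-cong zero    h = h _
  ∑perm-cong (suc n) h = sum-cong-≗ {suc n} λ j → ∑perm-cong n λ π → h (insert zero j π)

  ∑perm-+ : ∀ n (f g : Permutation′ n → ℕ) → ∑perm n (λ π → f π + g π) ≡ ∑perm n f + ∑perm n g
  ∑perm-+ zero    f g = refl
  ∑perm-+ (suc n) f g = trans (sum-cong-≗ {suc n} λ j → ∑perm-+ n (f ∘ insert zero j) (g ∘ insert zero j))
    (∑-distrib-+ {suc n} (λ j → ∑perm n (f ∘ insert zero j)) (λ j → ∑perm n (g ∘ insert zero j)))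

  ∑perm-*ˡ : ∀ n c (f : Permutation′ n → ℕ) → ∑perm n (λ π → c * f π) ≡ c * ∑perm n f
  ∑perm-*ˡ zero    c f = refl
  ∑perm-*ˡ (suc n) c f = begin
    sum (λ j → ∑perm n λ π → c * f (insert zero j π))    ≡⟨ sum-cong-≗ {suc n} (λ j → trans (∑perm-*ˡ n c (f ∘ insert zero j)) (*-comm c _)) ⟩
    sum (λ j → (∑perm n λ π → f (insert zero j π)) * c)  ≡⟨ sum-*ʳ {suc n} (λ j → ∑perm n (f ∘ insert zero j)) c ⟩
    ∑perm (suc n) f * c                                  ≡⟨ *-comm _ c ⟩
    c * ∑perm (suc n) f                                  ∎
    where open ≡-Reasoning

  ∑perm<⇒∃< : ∀ n (f : Permutation′ n → ℕ) (W : ℕ) → ∑perm n f < n ! * W → ∃ λ π → f π < W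
  ∑perm<⇒∃< zero    f W h = P.id , subst (f P.id <_) (+-identityʳ W) h
  ∑perm<⇒∃< (suc n) f W h with sum<⇒∃< {suc n} _ (n ! * W) (subst (∑perm (suc n) f <_) (*-assoc (suc n) (n !) W) h)
  ... | j , h′ with ∑perm<⇒∃< n _ W h′
  ...   | π , p = insert zero j π , p

  ∑col : ∀ n → (Vec Bool n → ℕ) → ℕ
  ∑col zero    f = f []
  ∑col (suc n) f = ∑col n (λ A → f (true ∷ A)) + ∑col n (λ A → f (false ∷ A))

  ∑col-mono-≤ : ∀ n {f g : Vec Bool n → ℕ} → (∀ A → f A ≤ g A) → ∑col n f ≤ ∑col n g
  ∑col-mono-≤ zero    h = h []
  ∑col-mono-≤ (suc n) h = +-mono-≤ (∑col-mono-≤ n (h ∘ (true ∷_))) (∑col-mono-≤ n (h ∘ (false ∷_)))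

  ∑col-*ˡ : ∀ n c (f : Vec Bool n → ℕ) → ∑col n (λ A → c * f A) ≡ c * ∑col n f
  ∑col-*ˡ zero    c f = refl
  ∑col-*ˡ (suc n) c f = trans (cong₂ _+_ (∑col-*ˡ n c _) (∑col-*ˡ n c _)) (sym (*-distribˡ-+ c (∑col n _) (∑col n _)))

  f≤∑col : ∀ n (f : Vec Bool n → ℕ) A → f A ≤ ∑col n f
  f≤∑col zero    f []          = ≤-refl
  f≤∑col (suc n) f (true  ∷ A) = ≤-trans (f≤∑col n _ A) (m≤m+n _ _)
  f≤∑col (suc n) f (false ∷ A) = ≤-trans (f≤∑col n _ A) (m≤n+m _ _)

  ∑perm-∑col : ∀ n k (f : Permutation′ n → Vec Bool k → ℕ) →
    ∑perm n (λ π → ∑col k (f π)) ≡ ∑col k (λ A → ∑perm n λ π → f π A)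
  ∑perm-∑col n zero    f = refl
  ∑perm-∑col n (suc k) f = trans (∑perm-+ n _ _) (cong₂ _+_ (∑perm-∑col n k _) (∑perm-∑col n k _))

  -- Generating functions of agreements

  pathAgreements : Bool → Vec Bool n → ℕ
  pathAgreements a []      = 0
  pathAgreements a (b ∷ A) = agree b a + pathAgreements b A

  module _ (q : ℕ) where

    q^agree-sum : ∀ a → q ^ agree a true + q ^ agree a false ≡ suc q
    q^agree-sum true  = trans (+-comm _ 1) (cong suc (*-identityʳ q))
    q^agree-sum false = cong suc (*-identityʳ q)

    -- At most t! f! of the n! permutations match the colouring A perfectly with B, whose classes have sizes t and f;
    -- the generating function of the number of agreements replaces this count by one that allows for errors.
    ∑perm-agreements : (A B : Fin n → Bool) →
      ∑perm n (λ π → q ^ agreements A (B ∘ (π ⟨$⟩ʳ_))) ≤ size B ! * size (not ∘ B) ! * suc q ^ n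
    ∑perm-agreements {zero}  A B = ≤-refl
    ∑perm-agreements {suc n} A B = begin
      ∑perm (suc n) (λ π → q ^ agreements A (B ∘ (π ⟨$⟩ʳ_)))
        ≤⟨ sum-mono-≤ {suc n} bound ⟩
      sum (λ j → χ (B j) * (w true * ct) + χ (not (B j)) * (w false * cf))
        ≡⟨ ∑-distrib-+ {suc n} (λ j → χ (B j) * (w true * ct)) (λ j → χ (not (B j)) * (w false * cf)) ⟩
      sum (λ j → χ (B j) * (w true * ct)) + sum (λ j → χ (not (B j)) * (w false * cf))
        ≡⟨ cong₂ _+_ (sum-*ʳ (χ ∘ B) (w true * ct)) (sum-*ʳ (χ ∘ not ∘ B) (w false * cf)) ⟩
      t * (w true * ct) + f * (w false * cf)
        ≤⟨ +-mono-≤ (absorb t f (w true)) (≤-trans (absorb f t (w false)) (≤-reflexive (cong (w false *_) (cong (_* suc q ^ n) (*-comm (f !) (t !)))))) ⟩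
      w true * (t ! * f ! * suc q ^ n) + w false * (t ! * f ! * suc q ^ n)
        ≡⟨ *-distribʳ-+ _ (w true) (w false) ⟨
      (w true + w false) * (t ! * f ! * suc q ^ n)
        ≡⟨ cong (_* (t ! * f ! * suc q ^ n)) (q^agree-sum (A zero)) ⟩
      suc q * (t ! * f ! * suc q ^ n)
        ≡⟨ solve 3 (λ x y z → x :* (y :* z) := y :* (x :* z)) refl (suc q) (t ! * f !) (suc q ^ n) ⟩
      t ! * f ! * suc q ^ suc n ∎
      where
      open ≤-Reasoning
      open +-*-Solver
      t = size B
      f = size (not ∘ B)
      w : Bool → ℕ
      w b = q ^ agree (A zero) b
      -- For `t` equal to 0 the value of `pred t` is a dummy: `ct` occurs only with the factor
      -- `χ (B j)`, and these factors sum to `t`. The same holds for `cf` and `f`.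
      ct = pred t ! * f ! * suc q ^ n
      cf = pred f ! * t ! * suc q ^ n

      absorb : ∀ t f v → t * (v * (pred t ! * f ! * suc q ^ n)) ≤ v * (t ! * f ! * suc q ^ n)
      absorb zero    f v = z≤n
      absorb (suc t) f v = ≤-reflexive (solve 5 (λ t v p f s → t :* (v :* (p :* f :* s)) := v :* (t :* p :* f :* s)) refl (suc t) v (t !) (f !) (suc q ^ n))

      bound : ∀ j → ∑perm n (λ π → q ^ agreements A (B ∘ (insert zero j π ⟨$⟩ʳ_)))
                  ≤ χ (B j) * (w true * ct) + χ (not (B j)) * (w false * cf)
      bound j = begin
        ∑perm n (λ π → q ^ (agree (A zero) (B j) + agreements (A ∘ suc) (B ∘ punchIn j ∘ (π ⟨$⟩ʳ_))))
          ≡⟨ ∑perm-cong n (λ π → ^-distribˡ-+-* q (agree (A zero) (B j)) _) ⟩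
        ∑perm n (λ π → w (B j) * q ^ agreements (A ∘ suc) (B ∘ punchIn j ∘ (π ⟨$⟩ʳ_)))
          ≡⟨ ∑perm-*ˡ n (w (B j)) _ ⟩
        w (B j) * ∑perm n (λ π → q ^ agreements (A ∘ suc) (B ∘ punchIn j ∘ (π ⟨$⟩ʳ_)))
          ≤⟨ *-monoʳ-≤ (w (B j)) (∑perm-agreements (A ∘ suc) (B ∘ punchIn j)) ⟩
        w (B j) * (size (B ∘ punchIn j) ! * size (not ∘ B ∘ punchIn j) ! * suc q ^ n)
          ≡⟨ pointwise (B j) (sum-remove (χ ∘ B)) (sum-remove (χ ∘ not ∘ B)) ⟩
        χ (B j) * (w true * ct) + χ (not (B j)) * (w false * cf) ∎
        where
        pointwise : ∀ b {t′ f′} → t ≡ χ b + t′ → f ≡ χ (not b) + f′ →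
          w b * (t′ ! * f′ ! * suc q ^ n) ≡ χ b * (w true * ct) + χ (not b) * (w false * cf)
        pointwise true  et ef rewrite et | ef = sym (trans (+-identityʳ _) (+-identityʳ _))
        pointwise false {t′} {f′} et ef rewrite et | ef = trans (cong (λ x → w false * (x * suc q ^ n)) (*-comm (t′ !) (f′ !))) (sym (+-identityʳ _))

    -- A further letter either repeats the previous one, with factor q, or differs from it, with
    -- factor 1, so it contributes 1 + q whatever came before.
    ∑col-path : ∀ n a → ∑col n (λ A → q ^ pathAgreements a A) ≡ suc q ^ n
    ∑col-path zero    a = refl
    ∑col-path (suc n) a = begin
      ∑col n (λ A → q ^ (agree true a + pathAgreements true A)) + ∑col n (λ A → q ^ (agree false a + pathAgreements false A))
        ≡⟨ cong₂ _+_ (half true) (half false) ⟩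
      q ^ agree true a * suc q ^ n + q ^ agree false a * suc q ^ n
        ≡⟨ *-distribʳ-+ (suc q ^ n) (q ^ agree true a) _ ⟨
      (q ^ agree true a + q ^ agree false a) * suc q ^ n
        ≡⟨ cong (_* suc q ^ n) (split a) ⟩
      suc q ^ suc n ∎
      where
      open ≡-Reasoning
      split : ∀ a → q ^ agree true a + q ^ agree false a ≡ suc q
      split true  = trans (+-comm _ 1) (cong suc (*-identityʳ q))
      split false = cong suc (*-identityʳ q)
      half : ∀ b → ∑col n (λ A → q ^ (agree b a + pathAgreements b A)) ≡ q ^ agree b a * suc q ^ n
      half b = trans (≤-antisym (∑col-mono-≤ n λ A → ≤-reflexive (^-distribˡ-+-* q (agree b a) _))
                                (∑col-mono-≤ n λ A → ≤-reflexive (sym (^-distribˡ-+-* q (agree b a) _))))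
               (trans (∑col-*ˡ n (q ^ agree b a) _) (cong (q ^ agree b a *_) (∑col-path n b)))

  -- Cyclic rotation and a binomial estimate

  predecessor successor : Fin (suc n) → Fin (suc n)
  predecessor {n} zero    = fromℕ n
  predecessor     (suc i) = inject₁ i
  successor {zero}  zero    = zero
  successor {suc n} zero    = suc zero
  successor {suc n} (suc i) with successor i
  ... | zero  = zero
  ... | suc j = suc (suc j)

  predecessor-successor : (i : Fin (suc n)) → predecessor (successor i) ≡ i
  predecessor-successor {zero}  zero = refl
  predecessor-successor {suc n} zero = refl
  predecessor-successor {suc n} (suc i) with successor i | predecessor-successor i
  ... | zero  | e = cong suc e
  ... | suc j | e = cong suc e

  successor-predecessor : (i : Fin (suc n)) → successor (predecessor i) ≡ i
  successor-predecessor {n} zero = successor-fromℕ n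
    where
    successor-fromℕ : ∀ n → successor (fromℕ n) ≡ zero
    successor-fromℕ zero = refl
    successor-fromℕ (suc n) rewrite successor-fromℕ n = refl
  successor-predecessor (suc i) = successor-inject₁ i
    where
    successor-inject₁ : (i : Fin n) → successor (inject₁ i) ≡ suc i
    successor-inject₁ zero = refl
    successor-inject₁ (suc i) rewrite successor-inject₁ i = refl

  -- The forward map is the predecessor, so at `suc i` it yields `inject₁ i`, and agreements under
  -- rotation unfold to agreements along a path.
  rotate : Permutation′ n
  rotate {zero}  = P.id
  rotate {suc n} = permutation predecessor successor predecessor-successor successor-predecessor

  -- The pair formed by the first and the last position lies outside the path; its possible
  -- agreement accounts for the `suc`.
  agreements-rotate : ∀ a (A : Vec Bool n) → agreements (lookup (a ∷ A)) (lookup (a ∷ A) ∘ (rotate ⟨$⟩ʳ_)) ≤ suc (pathAgreements a A)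
  agreements-rotate {n} a A = +-mono-≤ (χ≤1 _) (≤-reflexive (along-path a A))
    where
    χ≤1 : ∀ b → χ b ≤ 1
    χ≤1 true  = ≤-refl
    χ≤1 false = z≤n
    along-path : ∀ {n} a (A : Vec Bool n) → sum (λ i → agree (lookup (a ∷ A) (suc i)) (lookup (a ∷ A) (inject₁ i))) ≡ pathAgreements a A
    along-path a []      = refl
    along-path a (b ∷ A) = cong (agree b a +_) (along-path b A)

  -- Raising a and b together by one multiplies the binomial coefficient by (2 + a + b)(1 + a + b) /
  -- ((1 + a)(1 + b)), which is at least 2. This is the gain obtained from colour classes that both
  -- have size at least m.
  !*!*2^≤! : ∀ m {a b} → m ≤ a → m ≤ b → a ! * b ! * 2 ^ m ≤ (a + b) !
  !*!*2^≤! zero {a} {b} _ _ = subst (_≤ (a + b) !) (sym (*-identityʳ _))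
    (∣⇒≤ {{(a + b) !≢0}} (subst (λ x → x ! * b ! ∣ (a + b) !) (m+n∸n≡m a b) ([n∸k]!k!∣n! (m≤n+m b a))))
  !*!*2^≤! (suc m) {suc a} {suc b} (s≤s p) (s≤s q) = begin
    suc a ! * suc b ! * 2 ^ suc m
      ≡⟨ solve 5 (λ a b x y z → (con 1 :+ a) :* x :* ((con 1 :+ b) :* y) :* (con 2 :* z)
                  := con 2 :* (con 1 :+ a) :* (con 1 :+ b) :* (x :* y :* z)) refl a b (a !) (b !) (2 ^ m) ⟩
    2 * suc a * suc b * (a ! * b ! * 2 ^ m)
      ≤⟨ *-monoʳ-≤ (2 * suc a * suc b) (!*!*2^≤! m p q) ⟩
    2 * suc a * suc b * (a + b) !
      ≤⟨ *-monoˡ-≤ ((a + b) !) (m≤m+n (2 * suc a * suc b) (a * a + b * b + a + b)) ⟩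
    (2 * suc a * suc b + (a * a + b * b + a + b)) * (a + b) !
      ≡⟨ solve 3 (λ a b x → (con 2 :* (con 1 :+ a) :* (con 1 :+ b) :+ (a :* a :+ b :* b :+ a :+ b)) :* x
                  := (con 2 :+ (a :+ b)) :* ((con 1 :+ (a :+ b)) :* x)) refl a b ((a + b) !) ⟩
    (2 + (a + b)) !
      ≡⟨ cong _! (sym (cong suc (+-suc a b))) ⟩
    (suc a + suc b) ! ∎
    where
    open ≤-Reasoning
    open +-*-Solver

  -- Existence of an expanding permutation

  module _ (q m : ℕ) where

    balanced? : (A : Fin n → Bool) → Dec (m ≤ size A × m ≤ size (not ∘ A))
    balanced? A = (m ≤? size A) ×-dec (m ≤? size (not ∘ A))

    -- Only balanced colourings carry weight, since the gain `2 ^ m` is available only for them. The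
    -- decision is an argument so that proofs can split on it directly.
    weightIf : ∀ {P : Set} → Dec P → Permutation′ n → Vec Bool n → ℕ
    weightIf d π A = if does d
      then q ^ agreements (lookup A) (lookup A ∘ (rotate ⟨$⟩ʳ_)) * q ^ agreements (lookup A) (lookup A ∘ (π ⟨$⟩ʳ_))
      else 0

    weight : Permutation′ n → Vec Bool n → ℕ
    weight π A = weightIf (balanced? (lookup A)) π A

    ∑perm-0 : ∀ n → ∑perm n (λ _ → 0) ≡ 0
    ∑perm-0 n = ∑perm-*ˡ n 0 (λ _ → 0)

    ∑perm-weightIf : ∀ {k} (A : Vec Bool k) (d : Dec (m ≤ size (lookup A) × m ≤ size (not ∘ lookup A))) →
      2 ^ m * ∑perm k (λ π → weightIf d π A) ≤ k ! * suc q ^ k * q ^ agreements (lookup A) (lookup A ∘ (rotate ⟨$⟩ʳ_))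
    ∑perm-weightIf {k} A (no  _) = ≤-trans (≤-reflexive (trans (cong (2 ^ m *_) (∑perm-0 k)) (*-zeroʳ (2 ^ m)))) z≤n
    ∑perm-weightIf {k} A (yes (p , p′)) = begin
      2 ^ m * ∑perm k (λ π → r * q ^ agreements (lookup A) (lookup A ∘ (π ⟨$⟩ʳ_)))
        ≡⟨ cong (2 ^ m *_) (∑perm-*ˡ k r _) ⟩
      2 ^ m * (r * ∑perm k (λ π → q ^ agreements (lookup A) (lookup A ∘ (π ⟨$⟩ʳ_))))
        ≤⟨ *-monoʳ-≤ (2 ^ m) (*-monoʳ-≤ r (∑perm-agreements q (lookup A) (lookup A))) ⟩
      2 ^ m * (r * (a ! * b ! * suc q ^ k))
        ≡⟨ solve 4 (λ z r x s → z :* (r :* (x :* s)) := x :* z :* s :* r) refl (2 ^ m) r (a ! * b !) (suc q ^ k) ⟩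
      a ! * b ! * 2 ^ m * suc q ^ k * r
        ≤⟨ *-monoˡ-≤ r (*-monoˡ-≤ (suc q ^ k) (!*!*2^≤! m p p′)) ⟩
      (a + b) ! * suc q ^ k * r
        ≡⟨ cong (λ x → x ! * suc q ^ k * r) (size+size-not (lookup A)) ⟩
      k ! * suc q ^ k * r ∎
      where
      open ≤-Reasoning
      open +-*-Solver
      r = q ^ agreements (lookup A) (lookup A ∘ (rotate ⟨$⟩ʳ_))
      a = size (lookup A)
      b = size (not ∘ lookup A)

    module _ .{{_ : NonZero q}} where

      rotWeight : Vec Bool n → ℕ
      rotWeight A = q ^ agreements (lookup A) (lookup A ∘ (rotate ⟨$⟩ʳ_))

      -- The factor 2 stands for the free choice of the first letter, the factor q for the pair that
      -- wraps around.
      ∑col-rotate : ∀ n → ∑col n rotWeight ≤ 2 * q * suc q ^ n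
      ∑col-rotate zero    = ≤-trans (>-nonZero⁻¹ q) (≤-trans (m≤n*m q 2) (≤-reflexive (sym (*-identityʳ (2 * q)))))
      ∑col-rotate (suc n) = ≤-trans (+-mono-≤ (half true) (half false))
        (≤-trans (≤-reflexive (solve 2 (λ q s → q :* s :+ q :* s := con 2 :* q :* s) refl q (suc q ^ n)))
                 (*-monoʳ-≤ (2 * q) (^-monoʳ-≤ (suc q) (n≤1+n n))))
        where
        open +-*-Solver
        half : ∀ a → ∑col n (λ A → rotWeight (a ∷ A)) ≤ q * suc q ^ n
        half a = begin
          ∑col n (λ A → rotWeight (a ∷ A))
            ≤⟨ ∑col-mono-≤ n (λ A → ^-monoʳ-≤ q (agreements-rotate a A)) ⟩
          ∑col n (λ A → q * q ^ pathAgreements a A)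
            ≡⟨ ∑col-*ˡ n q (λ A → q ^ pathAgreements a A) ⟩
          q * ∑col n (λ A → q ^ pathAgreements a A)
            ≡⟨ cong (q *_) (∑col-path q n a) ⟩
          q * suc q ^ n ∎
          where open ≤-Reasoning

      ∑perm-∑col-weight : ∀ k →
        ∑perm k (λ π → 2 ^ m * ∑col k (weight π)) ≤ k ! * (suc q ^ k * (2 * q * suc q ^ k))
      ∑perm-∑col-weight k = begin
        ∑perm k (λ π → 2 ^ m * ∑col k (weight π))         ≡⟨ ∑perm-*ˡ k (2 ^ m) (λ π → ∑col k (weight π)) ⟩
        2 ^ m * ∑perm k (λ π → ∑col k (weight π))         ≡⟨ cong (2 ^ m *_) (∑perm-∑col k k weight) ⟩
        2 ^ m * ∑col k (λ A → ∑perm k λ π → weight π A)   ≡⟨ ∑col-*ˡ k (2 ^ m) (λ A → ∑perm k λ π → weight π A) ⟨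
        ∑col k (λ A → 2 ^ m * ∑perm k λ π → weight π A)   ≤⟨ ∑col-mono-≤ k (λ A → ∑perm-weightIf A (balanced? (lookup A))) ⟩
        ∑col k (λ A → k ! * suc q ^ k * rotWeight A)      ≡⟨ ∑col-*ˡ k (k ! * suc q ^ k) rotWeight ⟩
        k ! * suc q ^ k * ∑col k rotWeight                ≤⟨ *-monoʳ-≤ (k ! * suc q ^ k) (∑col-rotate k) ⟩
        k ! * suc q ^ k * (2 * q * suc q ^ k)             ≡⟨ *-assoc (k !) (suc q ^ k) (2 * q * suc q ^ k) ⟩
        k ! * (suc q ^ k * (2 * q * suc q ^ k))           ∎
        where
        open ≤-Reasoning

      -- Averaging gives one π for which the total weight of all colourings is small. The terms are
      -- nonnegative, so this total bounds every balanced colouring simultaneously.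
      ∃-mixing : ∀ k → ∃ λ (π : Permutation′ k) → ∀ A → m ≤ size (lookup A) → m ≤ size (not ∘ lookup A) →
        2 ^ m * q ^ (agreements (lookup A) (lookup A ∘ (rotate ⟨$⟩ʳ_)) + agreements (lookup A) (lookup A ∘ (π ⟨$⟩ʳ_)))
          ≤ suc q ^ k * (2 * q * suc q ^ k)
      -- The `suc` turns the bound on the average into the strict one that `∑perm<⇒∃<` expects;
      -- `≤-pred` takes it back.
      ∃-mixing k with ∑perm<⇒∃< k (λ π → 2 ^ m * ∑col k (weight π)) (suc (suc q ^ k * (2 * q * suc q ^ k)))
                        (≤-<-trans (∑perm-∑col-weight k) (*-monoʳ-< (k !) {{k !≢0}} (n<1+n (suc q ^ k * (2 * q * suc q ^ k)))))
      ... | π , h = π , λ A p p′ → ≤-trans (*-monoʳ-≤ (2 ^ m) (single A p p′)) (≤-pred h)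
        where
        single : ∀ A → m ≤ size (lookup A) → m ≤ size (not ∘ lookup A) →
          q ^ (agreements (lookup A) (lookup A ∘ (rotate ⟨$⟩ʳ_)) + agreements (lookup A) (lookup A ∘ (π ⟨$⟩ʳ_))) ≤ ∑col k (weight π)
        single A p p′ = ≤-trans (≤-reflexive (trans (^-distribˡ-+-* q (agreements (lookup A) (lookup A ∘ (rotate ⟨$⟩ʳ_))) _) (sym (weight-yes (balanced? (lookup A)))))) (f≤∑col k (weight π) A)
          where
          weight-yes : (d : Dec (m ≤ size (lookup A) × m ≤ size (not ∘ lookup A))) → weightIf d π A ≡ q ^ agreements (lookup A) (lookup A ∘ (rotate ⟨$⟩ʳ_)) * q ^ agreements (lookup A) (lookup A ∘ (π ⟨$⟩ʳ_))
          weight-yes (yes _) = refl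
          weight-yes (no ¬b) = contradiction (p , p′) ¬b

  ^-distribʳ-* : ∀ n x y → (x * y) ^ n ≡ x ^ n * y ^ n
  ^-distribʳ-* zero    x y = refl
  ^-distribʳ-* (suc n) x y = trans (cong (x * y *_) (^-distribʳ-* n x y))
    (solve 4 (λ x y a b → x :* y :* (a :* b) := x :* a :* (y :* b)) refl x y (x ^ n) (y ^ n))
    where open +-*-Solver

  2^-cancel-≤ : ∀ {a b} → 2 ^ a ≤ 2 ^ b → a ≤ b
  2^-cancel-≤ {a} {b} h with a ≤? b
  ... | yes p = p
  ... | no ¬p = contradiction (^-monoʳ-< 2 (s≤s (s≤s z≤n)) (≰⇒> ¬p)) (≤⇒≯ h)

  -- Compare fourth powers: since (1 + 1/q)^8 ≤ 2, the factor (1 + 1/q)^(2k), which accounts for both generating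
  -- functions, is at most 2^(k/4), and this is absorbed by the 2^m gained from balanced colourings.
  mixing-exponent : ∀ e k m g t → let q = 2 ^ e in suc q ^ 8 ≤ 2 * q ^ 8 →
    k + k ≤ g + t → 2 ^ m * q ^ g ≤ suc q ^ k * (2 * q * suc q ^ k) →
    4 * m ≤ k + 4 * (e * t) + suc e * 4
  mixing-exponent e k m g t growth h le = 2^-cancel-≤ (*-cancelʳ-≤ _ _ ((q ^ 8) ^ k) {{m^n≢0 (q ^ 8) k {{m^n≢0 q 8 {{m^n≢0 2 e}}}}}} (begin
    2 ^ (4 * m) * (q ^ 8) ^ k
      ≡⟨ cong₂ _*_ (trans (cong (2 ^_) (*-comm 4 m)) (sym (^-*-assoc 2 m 4))) (sym (eighth q)) ⟩
    (2 ^ m) ^ 4 * (q ^ (k + k)) ^ 4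
      ≡⟨ ^-distribʳ-* 4 (2 ^ m) (q ^ (k + k)) ⟨
    (2 ^ m * q ^ (k + k)) ^ 4
      ≤⟨ ^-monoˡ-≤ 4 base ⟩
    (2 ^ suc e * (p ^ (k + k) * q ^ t)) ^ 4
      ≡⟨ trans (^-distribʳ-* 4 (2 ^ suc e) (p ^ (k + k) * q ^ t)) (cong₂ _*_ (^-*-assoc 2 (suc e) 4) (^-distribʳ-* 4 (p ^ (k + k)) (q ^ t))) ⟩
    2 ^ (suc e * 4) * ((p ^ (k + k)) ^ 4 * (q ^ t) ^ 4)
      ≡⟨ cong₂ (λ x y → 2 ^ (suc e * 4) * (x * y)) (eighth p)
           (trans (cong (_^ 4) (^-*-assoc 2 e t)) (trans (^-*-assoc 2 (e * t) 4) (cong (2 ^_) (*-comm (e * t) 4)))) ⟩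
    2 ^ (suc e * 4) * ((p ^ 8) ^ k * 2 ^ (4 * (e * t)))
      ≤⟨ *-monoʳ-≤ (2 ^ (suc e * 4)) (*-monoˡ-≤ (2 ^ (4 * (e * t))) (^-monoˡ-≤ k growth)) ⟩
    2 ^ (suc e * 4) * ((2 * q ^ 8) ^ k * 2 ^ (4 * (e * t)))
      ≡⟨ cong (λ x → 2 ^ (suc e * 4) * (x * 2 ^ (4 * (e * t)))) (^-distribʳ-* k 2 (q ^ 8)) ⟩
    2 ^ (suc e * 4) * (2 ^ k * (q ^ 8) ^ k * 2 ^ (4 * (e * t)))
      ≡⟨ solve 4 (λ a b c d → a :* (b :* c :* d) := b :* d :* a :* c) refl (2 ^ (suc e * 4)) (2 ^ k) ((q ^ 8) ^ k) (2 ^ (4 * (e * t))) ⟩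
    2 ^ k * 2 ^ (4 * (e * t)) * 2 ^ (suc e * 4) * (q ^ 8) ^ k
      ≡⟨ cong (_* (q ^ 8) ^ k) (trans (cong (_* 2 ^ (suc e * 4)) (sym (^-distribˡ-+-* 2 k (4 * (e * t))))) (sym (^-distribˡ-+-* 2 (k + 4 * (e * t)) (suc e * 4)))) ⟩
    2 ^ (k + 4 * (e * t) + suc e * 4) * (q ^ 8) ^ k ∎))
    where
    open ≤-Reasoning
    open +-*-Solver
    q = 2 ^ e
    p = suc q
    eighth : ∀ x → (x ^ (k + k)) ^ 4 ≡ (x ^ 8) ^ k
    eighth x = trans (^-*-assoc x (k + k) 4) (trans (cong (x ^_) (solve 1 (λ k → (k :+ k) :* con 4 := con 8 :* k) refl k)) (sym (^-*-assoc x 8 k)))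
    base : 2 ^ m * q ^ (k + k) ≤ 2 ^ suc e * (p ^ (k + k) * q ^ t)
    base = begin
      2 ^ m * q ^ (k + k)                    ≤⟨ *-monoʳ-≤ (2 ^ m) (^-monoʳ-≤ q {{m^n≢0 2 e}} h) ⟩
      2 ^ m * q ^ (g + t)                    ≡⟨ cong (2 ^ m *_) (^-distribˡ-+-* q g t) ⟩
      2 ^ m * (q ^ g * q ^ t)                ≡⟨ *-assoc (2 ^ m) _ _ ⟨
      2 ^ m * q ^ g * q ^ t                  ≤⟨ *-monoˡ-≤ (q ^ t) le ⟩
      p ^ k * (2 ^ suc e * p ^ k) * q ^ t    ≡⟨ solve 3 (λ x y z → x :* (z :* x) :* y := z :* (x :* x :* y)) refl (p ^ k) (q ^ t) (2 ^ suc e) ⟩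
      2 ^ suc e * (p ^ k * p ^ k * q ^ t)    ≡⟨ cong (λ x → 2 ^ suc e * (x * q ^ t)) (sym (^-distribˡ-+-* p k k)) ⟩
      2 ^ suc e * (p ^ (k + k) * q ^ t)      ∎

  -- Here `t` is any bound on the total displacement of A under the rotation and π. For m near k / 2
  -- the left side of the conclusion is near 2k, which forces `t` to be linear in k: every balanced
  -- set is moved substantially.
  ∃-expanding : ∀ e → suc (2 ^ e) ^ 8 ≤ 2 * (2 ^ e) ^ 8 → ∀ k m →
    ∃ λ (π : Permutation′ k) → ∀ (A : Vec Bool k) t →
    m ≤ size (lookup A) → m ≤ size (not ∘ lookup A) →
    k + k ≤ agreements (lookup A) (lookup A ∘ (rotate ⟨$⟩ʳ_)) + agreements (lookup A) (lookup A ∘ (π ⟨$⟩ʳ_)) + t →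
    4 * m ≤ k + 4 * (e * t) + suc e * 4
  ∃-expanding e growth k m with ∃-mixing (2 ^ e) m {{m^n≢0 2 e}} k
  ... | π , h = π , λ A t p p′ q → mixing-exponent e k m
    (agreements (lookup A) (lookup A ∘ (rotate ⟨$⟩ʳ_)) + agreements (lookup A) (lookup A ∘ (π ⟨$⟩ʳ_))) t growth q (h A p p′)

  -- Among powers of two, 16 is the least q with (1 + 1/q)^8 ≤ 2. A power of two is taken because
  -- all quantities are finally compared as powers of 2.
  17^8≤2*16^8 : suc (2 ^ 4) ^ 8 ≤ 2 * (2 ^ 4) ^ 8
  17^8≤2*16^8 = ≤ᵇ⇒≤ (suc (2 ^ 4) ^ 8) (2 * (2 ^ 4) ^ 8) tt

  -- Abstract because normalising 17^8≤2*16^8 would build a unary proof of astronomical size.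
  abstract
    ∃-expander : ∀ k m → ∃ λ (π : Permutation′ k) → ∀ (A : Vec Bool k) t →
      m ≤ size (lookup A) → m ≤ size (not ∘ lookup A) →
      k + k ≤ agreements (lookup A) (lookup A ∘ (rotate ⟨$⟩ʳ_)) + agreements (lookup A) (lookup A ∘ (π ⟨$⟩ʳ_)) + t →
      4 * m ≤ k + 4 * (4 * t) + 20
    ∃-expander = ∃-expanding 4 17^8≤2*16^8

-- Near-complementary sets and labelled covers

module Labellings where

  open Mixing
  open import Data.Nat
  open import Data.Nat.Properties
  open import Data.Nat.Solver using (module +-*-Solver)
  open import Relation.Binary.Construct.Closure.ReflexiveTransitive as Star using (Star; ε; _◅_)
  open import Algebra.Properties.CommutativeMonoid.Sum +-0-commutativeMonoid

  private variable n k : ℕ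

  -- The Hamming distance; A and B are nearly complementary when `distance A (not ∘ B)` is small.
  distance : (A B : Fin n → Bool) → ℕ
  distance A B = agreements A (not ∘ B)

  sum-≗-+ : (f g h : Fin n → ℕ) → (∀ i → f i ≡ g i + h i) → sum f ≡ sum g + sum h
  sum-≗-+ f g h e = trans (sum-cong-≗ e) (∑-distrib-+ g h)

  distance-cong : {A A′ B B′ : Fin n → Bool} → A ≗ A′ → B ≗ B′ → distance A B ≡ distance A′ B′
  distance-cong p q = sum-cong-≗ λ i → cong₂ (λ a b → agree a (not b)) (p i) (q i)

  agreements+distance : (A B : Fin n → Bool) → agreements A B + distance A B ≡ n
  agreements+distance {n} A B = trans (sym (sum-≗-+ (λ _ → 1) _ _ λ i → sym (pointwise (A i) (B i)))) (trans (sum-const n 1) (*-identityʳ n))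
    where
    pointwise : ∀ a b → agree a b + agree a (not b) ≡ 1
    pointwise true  true  = refl
    pointwise true  false = refl
    pointwise false true  = refl
    pointwise false false = refl

  distance-triangle : (A B C : Fin n → Bool) → distance A C ≤ distance A B + distance B C
  distance-triangle A B C = ≤-trans (sum-mono-≤ λ i → pointwise (A i) (B i) (C i)) (≤-reflexive (∑-distrib-+ (λ i → agree (A i) (not (B i))) (λ i → agree (B i) (not (C i)))))
    where
    pointwise : ∀ a b c → agree a (not c) ≤ agree a (not b) + agree b (not c)
    pointwise true  true  c     = ≤-refl
    pointwise true  false true  = z≤n
    pointwise true  false false = s≤s z≤n
    pointwise false true  true  = s≤s z≤n
    pointwise false true  false = z≤n
    pointwise false false c     = ≤-refl

  distance-not : (A B : Fin n → Bool) → distance (not ∘ A) (not ∘ B) ≡ distance A B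
  distance-not A B = sum-cong-≗ λ i → pointwise (A i) (B i)
    where
    pointwise : ∀ a b → agree (not a) (not (not b)) ≡ agree a (not b)
    pointwise true  true  = refl
    pointwise true  false = refl
    pointwise false true  = refl
    pointwise false false = refl

  distance-sym : (A B : Fin n → Bool) → distance A B ≡ distance B A
  distance-sym A B = sum-cong-≗ λ i → pointwise (A i) (B i)
    where
    pointwise : ∀ a b → agree a (not b) ≡ agree b (not a)
    pointwise true  true  = refl
    pointwise true  false = refl
    pointwise false true  = refl
    pointwise false false = refl

  distance-permute : (A B : Fin n → Bool) (π : Permutation′ n) → distance (A ∘ (π ⟨$⟩ʳ_)) (B ∘ (π ⟨$⟩ʳ_)) ≡ distance A B
  distance-permute A B π = sym (∑-permute (λ i → agree (A i) (not (B i))) π)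

  distance-refl : (A : Fin n → Bool) → distance A A ≡ 0
  distance-refl {n} A = trans (sum-cong-≗ λ i → pointwise (A i)) (trans (sum-const n 0) (*-zeroʳ n))
    where
    pointwise : ∀ a → agree a (not a) ≡ 0
    pointwise true  = refl
    pointwise false = refl

  distance-refl-not : (A : Fin n → Bool) → distance A (not ∘ A) ≡ n
  distance-refl-not {n} A = trans (sum-cong-≗ λ i → pointwise (A i)) (trans (sum-const n 1) (*-identityʳ n))
    where
    pointwise : ∀ a → agree a (not (not a)) ≡ 1
    pointwise true  = refl
    pointwise false = refl

  distance≡0 : (A B : Fin n → Bool) → distance A B ≡ 0 → A ≗ B
  distance≡0 A B h zero    = pointwise (A zero) (B zero) (m+n≡0⇒m≡0 _ h)
    where
    pointwise : ∀ a b → agree a (not b) ≡ 0 → a ≡ b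
    pointwise true  true  _ = refl
    pointwise false false _ = refl
  distance≡0 A B h (suc i) = distance≡0 (A ∘ suc) (B ∘ suc) (m+n≡0⇒n≡0 (agree (A zero) (not (B zero))) h) i

  Disjoint : (A B : Fin n → Bool) → Set
  Disjoint A B = ∀ i → A i ≡ true → B i ≡ true → ⊥

  -- Disjointness leaves points of A only, of B only, and of neither; `distance A (not ∘ B)` counts
  -- the last kind.
  size-disjoint : {A B : Fin n → Bool} → Disjoint A B → distance A (not ∘ B) + (size A + size B) ≡ n
  size-disjoint {n} {A} {B} disj = begin
    distance A (not ∘ B) + (size A + size B)
      ≡⟨ cong (distance A (not ∘ B) +_) (∑-distrib-+ (χ ∘ A) (χ ∘ B)) ⟨
    distance A (not ∘ B) + sum (λ i → χ (A i) + χ (B i))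
      ≡⟨ sum-≗-+ (λ _ → 1) _ _ (λ i → sym (pointwise (A i) (B i) (disj i))) ⟨
    sum {n} (λ _ → 1)
      ≡⟨ trans (sum-const n 1) (*-identityʳ n) ⟩
    n ∎
    where
    open ≡-Reasoning
    pointwise : ∀ a b → (a ≡ true → b ≡ true → _) → agree a (not (not b)) + (χ a + χ b) ≡ 1
    pointwise true  true  h = contradiction refl (h refl)
    pointwise true  false _ = refl
    pointwise false true  _ = refl
    pointwise false false _ = refl

  distance-disjoint : ∀ {δ} {A B : Fin n → Bool} → Disjoint A B → n ≤ 2 * size A + δ → n ≤ 2 * size B + δ → distance A (not ∘ B) ≤ δ
  distance-disjoint {n} {δ} {A} {B} disj hA hB = *-cancelˡ-≤ 2 (+-cancelʳ-≤ (2 * (size A + size B)) _ _ (begin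
    2 * distance A (not ∘ B) + 2 * (size A + size B)  ≡⟨ *-distribˡ-+ 2 (distance A (not ∘ B)) _ ⟨
    2 * (distance A (not ∘ B) + (size A + size B))    ≡⟨ cong (2 *_) (size-disjoint disj) ⟩
    2 * n                                             ≡⟨ cong (n +_) (+-identityʳ n) ⟩
    n + n                                             ≤⟨ +-mono-≤ hA hB ⟩
    2 * size A + δ + (2 * size B + δ)                 ≡⟨ solve 3 (λ a b d → con 2 :* a :+ d :+ (con 2 :* b :+ d) := con 2 :* d :+ con 2 :* (a :+ b)) refl (size A) (size B) δ ⟩
    2 * δ + 2 * (size A + size B)                     ∎))
    where
    open ≤-Reasoning
    open +-*-Solver

  ∣∣≡size : (S : Subset n) → ∣ S ∣ ≡ size (lookup S)
  ∣∣≡size []          = refl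
  ∣∣≡size (true  ∷ S) = cong suc (∣∣≡size S)
  ∣∣≡size (false ∷ S) = ∣∣≡size S

  not^ : ℕ → Bool → Bool
  not^ zero    b = b
  not^ (suc ℓ) b = not (not^ ℓ b)

  not^-parity : ∀ ℓ → (2 ∣ ℓ × ∀ b → not^ ℓ b ≡ b) ⊎ (2 ∣ suc ℓ × ∀ b → not^ ℓ b ≡ not b)
  not^-parity zero    = inj₁ (2 ∣0 , λ _ → refl)
  not^-parity (suc ℓ) with not^-parity ℓ
  ... | inj₁ (d , e) = inj₂ (∣m∣n⇒∣m+n (∣-refl {2}) d , λ b → cong not (e b))
  ... | inj₂ (d , e) = inj₁ (d , λ b → trans (cong not (e b)) (B.not-involutive b))

  length : ∀ {V : Set} {R : V → V → Set} {u v} → Star R u v → ℕ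
  length ε       = 0
  length (_ ◅ w) = suc (length w)

  distance-walk : ∀ {V : Set} {R : V → V → Set} (S : V → Fin k → Bool) {δ} →
    (∀ {u v} → R u v → distance (S u) (not ∘ S v) ≤ δ) →
    ∀ {u v} (w : Star R u v) → distance (S u) (not^ (length w) ∘ S v) ≤ length w * δ
  distance-walk S near {u} ε = ≤-reflexive (distance-refl (S u))
  distance-walk S {δ} near {u} {v} (_◅_ {j = x} r w) = begin
    distance (S u) (not ∘ not^ (length w) ∘ S v)
      ≤⟨ distance-triangle (S u) (not ∘ S x) (not ∘ not^ (length w) ∘ S v) ⟩
    distance (S u) (not ∘ S x) + distance (not ∘ S x) (not ∘ not^ (length w) ∘ S v)
      ≤⟨ +-mono-≤ (near r) (≤-trans (≤-reflexive (distance-not (S x) (not^ (length w) ∘ S v))) (distance-walk S near w)) ⟩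
    δ + length w * δ ∎
    where open ≤-Reasoning

  SameEdge : (u v x y : Fin n) → Set
  SameEdge u v x y = (u ≡ x × v ≡ y) ⊎ (u ≡ y × v ≡ x)

  sameEdge? : (u v x y : Fin n) → Dec (SameEdge u v x y)
  sameEdge? u v x y = ((u F.≟ x) ×-dec (v F.≟ y)) ⊎-dec ((u F.≟ y) ×-dec (v F.≟ x))

  -- An integer form of colourings with η near 1/2: `δ` bounds how far twice the size of each set
  -- may fall short of k, and `δ = 0` means halves.
  Colourable : Graph → ℕ → ℕ → Set
  Colourable G k δ = (H : Cover G k) → Σ (Fin (order G) → Subset k) λ S → QuasiIndependent H S × (∀ u → k ≤ 2 * ∣ S u ∣ + δ)

  -- Covers from permutation labellings

  module _ (G : Graph) where

    private V = Fin (order G)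

    Adj : V → V → Set
    Adj u v = adj G u v ≡ true

    Adj-sym : ∀ {u v} → Adj u v → Adj v u
    Adj-sym {u} {v} e = trans (adj-sym G v u) e

    Adj-irrefl : ∀ {u} → ¬ Adj u u
    Adj-irrefl {u} e = contradiction (trans (sym e) (irrefl G u)) λ ()

    Labelling : ℕ → Set
    Labelling k = Σ (V → V → Permutation′ k) λ π → ∀ u v i → π v u ⟨$⟩ʳ (π u v ⟨$⟩ʳ i) ≡ i

    labelledCover : Labelling k → Cover G k
    labelledCover {k} (π , inv) = record
      { cross     = λ u v i j → adj G u v ∧ does (π u v ⟨$⟩ʳ i F.≟ j)
      ; crossSym  = λ u v i j → cong₂ _∧_ (adj-sym G u v) (does-⇔ (mk⇔ (flip u v) (flip v u)) (_ F.≟ _) (_ F.≟ _))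
      ; crossAdj  = λ u v i j h → proj₁ (split h)
      ; matchingˡ = λ u v i j j′ h h′ → trans (sym (label (adj G u v) {π u v ⟨$⟩ʳ i} {j} h)) (label (adj G u v) {π u v ⟨$⟩ʳ i} {j′} h′)
      ; matchingʳ = λ u v i i′ j h h′ → trans (sym (inv u v i)) (trans (cong (π v u ⟨$⟩ʳ_) (trans (label (adj G u v) {π u v ⟨$⟩ʳ i} {j} h) (sym (label (adj G u v) {π u v ⟨$⟩ʳ i′} {j} h′)))) (inv u v i′))
      }
      where
      flip : ∀ u v {i j} → π u v ⟨$⟩ʳ i ≡ j → π v u ⟨$⟩ʳ j ≡ i
      flip u v {i} refl = inv u v i
      split : ∀ {a b} → a ∧ b ≡ true → a ≡ true × b ≡ true
      split {true} h = refl , h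
      label : ∀ a {i j : Fin k} → a ∧ does (i F.≟ j) ≡ true → i ≡ j
      label true {i} {j} h with i F.≟ j
      ... | yes e = e

    disjoint-labelled : ((π , inv) : Labelling k) (S : V → Subset k) → QuasiIndependent (labelledCover (π , inv)) S →
      ∀ {u v} → Adj u v → Disjoint (lookup (S u)) (lookup (S v) ∘ (π u v ⟨$⟩ʳ_))
    disjoint-labelled (π , inv) S qi {u} {v} uv i p q =
      qi u v i (π u v ⟨$⟩ʳ i) on-edge (lookup⇒[]= i (S u) p) (lookup⇒[]= (π u v ⟨$⟩ʳ i) (S v) q)
      where
      on-edge : adj G u v ∧ does (π u v ⟨$⟩ʳ i F.≟ π u v ⟨$⟩ʳ i) ≡ true
      on-edge with π u v ⟨$⟩ʳ i F.≟ π u v ⟨$⟩ʳ i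
      ... | yes _ = cong (_∧ true) uv
      ... | no ¬e = contradiction refl ¬e

    distance-labelled : ∀ {δ} (ℒ : Labelling k) (S : V → Subset k) →
      QuasiIndependent (labelledCover ℒ) S → (∀ u → k ≤ 2 * ∣ S u ∣ + δ) →
      ∀ {u v} → Adj u v → distance (lookup (S u)) (not ∘ lookup (S v) ∘ (proj₁ ℒ u v ⟨$⟩ʳ_)) ≤ δ
    distance-labelled {k} {δ} ℒ S qi large {u} {v} uv = distance-disjoint
      (disjoint-labelled ℒ S qi uv)
      (subst (λ s → k ≤ 2 * s + δ) (∣∣≡size (S u)) (large u))
      (subst (λ s → k ≤ 2 * s + δ) (trans (∣∣≡size (S v)) (∑-permute (χ ∘ lookup (S v)) (proj₁ ℒ u v))) (large v))

    identityLabelling : Labelling k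
    identityLabelling = (λ _ _ → P.id) , λ _ _ _ → refl

    -- Each step of the walk nearly complements the set, and the errors add. After an odd number of
    -- steps S u is within `length w * δ` of its own complement, from which its distance is k.
    odd-closed-walk : ∀ {δ u} (w : Star Adj u u) → ¬ (2 ∣ length w) → Colourable G k δ → k ≤ length w * δ
    odd-closed-walk {k} {δ} {u} w odd col with col (labelledCover identityLabelling)
    ... | S , qi , large with not^-parity (length w)
    ...   | inj₁ (even , _) = contradiction even odd
    ...   | inj₂ (_ , e)    = ≤-trans
      (≤-reflexive (trans (sym (distance-refl-not (lookup (S u)))) (distance-cong (λ _ → refl) (λ i → sym (e (lookup (S u) i))))))
      (distance-walk (lookup ∘ S) (distance-labelled identityLabelling S qi large) w)

    relabel : (x y : V) → x ≢ y → Permutation′ k → Labelling k → Labelling k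
    relabel {k} x y x≢y σ (π , inv) = π′ , inv′
      where
      π′ : V → V → Permutation′ k
      π′ u v with (u F.≟ x) ×-dec (v F.≟ y) | (u F.≟ y) ×-dec (v F.≟ x)
      ... | yes _ | _     = σ
      ... | no _  | yes _ = P.flip σ
      ... | no _  | no _  = π u v
      inv′ : ∀ u v i → π′ v u ⟨$⟩ʳ (π′ u v ⟨$⟩ʳ i) ≡ i
      inv′ u v i with (u F.≟ x) ×-dec (v F.≟ y) | (u F.≟ y) ×-dec (v F.≟ x) | (v F.≟ x) ×-dec (u F.≟ y) | (v F.≟ y) ×-dec (u F.≟ x)
      ... | yes (refl , refl) | _ | yes (refl , _) | _ = contradiction refl x≢y
      ... | yes _ | _ | no _ | yes _ = P.inverseˡ σ
      ... | yes (p , q) | _ | no _ | no ¬p = contradiction (q , p) ¬p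
      ... | no _ | yes _ | yes _ | _ = P.inverseʳ σ
      ... | no _ | yes (p , q) | no ¬p | _ = contradiction (q , p) ¬p
      ... | no _ | no ¬p | yes (p , q) | _ = contradiction (q , p) ¬p
      ... | no ¬p | no _ | no _ | yes (p , q) = contradiction (q , p) ¬p
      ... | no _ | no _ | no _ | no _ = inv u v i

    relabel-at : ∀ x y x≢y (σ : Permutation′ k) ℒ → proj₁ (relabel x y x≢y σ ℒ) x y ≡ σ
    relabel-at x y x≢y σ ℒ with (x F.≟ x) ×-dec (y F.≟ y)
    ... | yes _ = refl
    ... | no ¬p = contradiction (refl , refl) ¬p

    relabel-away : ∀ x y x≢y (σ : Permutation′ k) ℒ {u v} → ¬ SameEdge u v x y → proj₁ (relabel x y x≢y σ ℒ) u v ≡ proj₁ ℒ u v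
    relabel-away x y x≢y σ ℒ {u} {v} ¬same with (u F.≟ x) ×-dec (v F.≟ y) | (u F.≟ y) ×-dec (v F.≟ x)
    ... | yes p | _     = contradiction (inj₁ p) ¬same
    ... | no _  | yes p = contradiction (inj₂ p) ¬same
    ... | no _  | no _  = refl

    -- A and B are the classes of x and y: going from x to y along the edge labelled σ and back along an odd walk complements
    -- an even number of times.
    distance-holonomy : ∀ {δ} (A B : Fin k → Bool) (σ : Permutation′ k) ℓ →
      (∀ b → not^ ℓ b ≡ not b) → distance A (not ∘ B ∘ (σ ⟨$⟩ʳ_)) ≤ δ → distance B (not^ ℓ ∘ A) ≤ ℓ * δ →
      distance A (A ∘ (σ ⟨$⟩ʳ_)) ≤ suc ℓ * δ
    distance-holonomy {k} {δ} A B σ ℓ odd h h′ = begin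
      distance A Aσ
        ≤⟨ distance-triangle A (not ∘ Bσ) Aσ ⟩
      distance A (not ∘ Bσ) + distance (not ∘ Bσ) Aσ
        ≡⟨ cong (distance A (not ∘ Bσ) +_) (trans (distance-cong (λ _ → refl) (λ i → sym (B.not-involutive (Aσ i))))
             (trans (distance-not Bσ (not ∘ Aσ)) (distance-permute B (not ∘ A) σ))) ⟩
      distance A (not ∘ Bσ) + distance B (not ∘ A)
        ≡⟨ cong (distance A (not ∘ Bσ) +_) (distance-cong (λ _ → refl) (λ i → sym (odd (A i)))) ⟩
      distance A (not ∘ Bσ) + distance B (not^ ℓ ∘ A)
        ≤⟨ +-mono-≤ h h′ ⟩
      δ + ℓ * δ ∎
      where
      open ≤-Reasoning
      Aσ = A ∘ (σ ⟨$⟩ʳ_)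
      Bσ = B ∘ (σ ⟨$⟩ʳ_)

    parity-even⇒odd-closed : ∀ {R : V → V → Set} {x y} → (∀ {u v} → R u v → Adj u v) → Adj x y → (w : Star R y x) → 2 ∣ length w →
      Σ (Star Adj x x) λ w′ → ¬ (2 ∣ length w′)
    parity-even⇒odd-closed R⇒Adj xy w even = (xy ◅ Star.map R⇒Adj w) , λ d → ¬2∣1 (∣m+n∣m⇒∣n (subst (2 ∣_) (trans (cong suc (length-map w)) (+-comm 1 _)) d) even)
      where
      ¬2∣1 : ¬ (2 ∣ 1)
      ¬2∣1 (divides (suc _) ())
      length-map : ∀ {u v} (w : Star _ u v) → length (Star.map R⇒Adj w) ≡ length w
      length-map ε       = refl
      length-map (_ ◅ w) = cong suc (length-map w)

  invariant-rotate⇒constant : (A : Fin (suc n) → Bool) → A ≗ A ∘ (rotate ⟨$⟩ʳ_) → ∀ i → A i ≡ A zero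
  invariant-rotate⇒constant {n} A h = const A (h ∘ suc)
    where
    const : ∀ {n} (A : Fin (suc n) → Bool) → (∀ i → A (suc i) ≡ A (inject₁ i)) → ∀ i → A i ≡ A zero
    const A h zero    = refl
    const {suc n} A h (suc i) = trans (const (A ∘ suc) (h ∘ suc) i) (h zero)

  module _ (G : Graph) {x y : Fin (order G)} where

    private
      V = Fin (order G)
      x≢y : Adj G x y → x ≢ y
      x≢y xy refl = Adj-irrefl G xy

    Without : V → V → Set
    Without u v = Adj G u v × ¬ SameEdge u v x y

    ¬exactly-half : ∀ {k} → Adj G x y → Star Without y x → ¬ Colourable G (suc k) 0
    ¬exactly-half {k} xy w col with not^-parity (length w)
    -- An even way back from y to x closes with the edge xy to an odd closed walk, which rules out
    -- halves already under identity labels.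
    ... | inj₁ (even , _) with parity-even⇒odd-closed G proj₁ xy w even
    ...   | w′ , odd with odd-closed-walk G w′ odd col
    ...     | h = contradiction (≤-trans h (≤-reflexive (*-zeroʳ (length w′)))) λ ()
    ¬exactly-half {k} xy w col | inj₂ (_ , odd) with col (labelledCover G (relabel G x y (x≢y xy) rotate (identityLabelling G)))
    ... | S , qi , large = contra (A zero) constant
      where
      ℒ = relabel G x y (x≢y xy) rotate (identityLabelling G)
      A B : Fin (suc k) → Bool
      A = lookup (S x)
      B = lookup (S y)
      near : ∀ {u v} → Adj G u v → distance (lookup (S u)) (not ∘ lookup (S v) ∘ (proj₁ ℒ u v ⟨$⟩ʳ_)) ≤ 0
      near = distance-labelled G ℒ S qi large
      near-xy : distance A (not ∘ B ∘ (rotate ⟨$⟩ʳ_)) ≤ 0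
      near-xy = subst (λ σ → distance A (not ∘ B ∘ (σ ⟨$⟩ʳ_)) ≤ 0) (relabel-at G x y (x≢y xy) rotate (identityLabelling G)) (near xy)
      near-walk : ∀ {u v} → Without u v → distance (lookup (S u)) (not ∘ lookup (S v)) ≤ 0
      near-walk {u} {v} (uv , ¬same) = subst (λ σ → distance (lookup (S u)) (not ∘ lookup (S v) ∘ (σ ⟨$⟩ʳ_)) ≤ 0)
        (relabel-away G x y (x≢y xy) rotate (identityLabelling G) ¬same) (near uv)
      constant : ∀ i → A i ≡ A zero
      constant = invariant-rotate⇒constant A (distance≡0 A _ (n≤0⇒n≡0 (≤-trans
        (distance-holonomy G A B rotate (length w) odd near-xy (distance-walk (lookup ∘ S) near-walk w))
        (≤-reflexive (*-zeroʳ (suc (length w)))))))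
      size-A : ∀ b → (∀ i → A i ≡ b) → size A ≡ suc k * χ b
      size-A b h = trans (sum-cong-≗ (λ i → cong χ (h i))) (sum-const (suc k) (χ b))
      large-A : suc k ≤ 2 * size A
      large-A = subst (suc k ≤_) (trans (+-identityʳ _) (cong (2 *_) (∣∣≡size (S x)))) (large x)
      large-B : suc k ≤ 2 * size B
      large-B = subst (suc k ≤_) (trans (+-identityʳ _) (cong (2 *_) (∣∣≡size (S y)))) (large y)
      size≤ : size A + size B ≤ suc k
      size≤ = begin
        size A + size B                               ≡⟨ cong (size A +_) (∑-permute (χ ∘ B) (label x y)) ⟩
        size A + size (B ∘ (label x y ⟨$⟩ʳ_))         ≤⟨ m≤n+m _ (distance A (not ∘ B ∘ (label x y ⟨$⟩ʳ_))) ⟩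
        _                                             ≡⟨ size-disjoint (disjoint-labelled G ℒ S qi xy) ⟩
        suc k                                         ∎
        where
        open ≤-Reasoning
        label = proj₁ ℒ
      contra : ∀ b → (∀ i → A i ≡ b) → ⊥
      -- If A is the whole list, disjointness across xy leaves B empty, whereas B has to contain at
      -- least half.
      contra true h = contradiction large-B (<⇒≱ (≤-<-trans (*-monoʳ-≤ 2 {size B} {0} (+-cancelˡ-≤ (suc k) _ _ (begin
        suc k + size B        ≡⟨ cong (_+ size B) (trans (size-A true h) (*-identityʳ (suc k))) ⟨
        size A + size B       ≤⟨ size≤ ⟩
        suc k                 ≡⟨ +-identityʳ (suc k) ⟨
        suc k + 0             ∎))) (s≤s z≤n)))
        where open ≤-Reasoning
      contra false h = contradiction large-A (<⇒≱ (≤-<-trans (≤-reflexive (cong (2 *_) (trans (size-A false h) (*-zeroʳ (suc k))))) (s≤s z≤n)))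

  x≤1+2*⌊x/2⌋ : ∀ x → x ≤ suc (2 * ⌊ x /2⌋)
  x≤1+2*⌊x/2⌋ zero          = z≤n
  x≤1+2*⌊x/2⌋ (suc zero)    = ≤-refl
  x≤1+2*⌊x/2⌋ (suc (suc x)) = s≤s (subst (suc x ≤_) (sym (*-suc 2 ⌊ x /2⌋)) (s≤s (x≤1+2*⌊x/2⌋ x)))

  -- The hypotheses give 2k ≤ 4m + 2 `suc δ` + 2, hence k ≤ 16 L `suc δ` + 2 `suc δ` + 22. As
  -- `suc δ` is at least 1, the constant 22 is at most 22 `suc δ`, and 22 + 2 is the 24.
  deficiency-arithmetic : ∀ k δ L m → k ∸ suc δ ≤ suc (2 * m) → 4 * m ≤ k + 4 * (4 * (L * suc δ)) + 20 → k ≤ (24 + 16 * L) * suc δ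
  deficiency-arithmetic k δ L m h h′ = +-cancelˡ-≤ k _ _ (begin
    k + k                                                ≤⟨ +-mono-≤ k≤ k≤ ⟩
    (suc δ + suc (2 * m)) + (suc δ + suc (2 * m))        ≡⟨ solve 2 (λ d m → (d :+ (con 1 :+ con 2 :* m)) :+ (d :+ (con 1 :+ con 2 :* m)) := con 4 :* m :+ (con 2 :* d :+ con 2)) refl (suc δ) m ⟩
    4 * m + (2 * suc δ + 2)                              ≤⟨ +-monoˡ-≤ (2 * suc δ + 2) h′ ⟩
    k + 4 * (4 * (L * suc δ)) + 20 + (2 * suc δ + 2)     ≤⟨ m≤m+n _ (22 * δ) ⟩
    k + 4 * (4 * (L * suc δ)) + 20 + (2 * suc δ + 2) + 22 * δ
      ≡⟨ solve 3 (λ k L δ → k :+ con 4 :* (con 4 :* (L :* (con 1 :+ δ))) :+ con 20 :+ (con 2 :* (con 1 :+ δ) :+ con 2) :+ con 22 :* δ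
                          := k :+ (con 24 :+ con 16 :* L) :* (con 1 :+ δ)) refl k L δ ⟩
    k + (24 + 16 * L) * suc δ                            ∎)
    where
    open ≤-Reasoning
    open +-*-Solver
    k≤ : k ≤ suc δ + suc (2 * m)
    k≤ = ≤-trans (m≤n+m∸n k (suc δ)) (+-monoʳ-≤ (suc δ) h)

  module _ (G : Graph) {x₁ y₁ x₂ y₂ : Fin (order G)} where

    private
      V = Fin (order G)

    Without₂ : V → V → Set
    Without₂ u v = Adj G u v × ¬ SameEdge u v x₁ y₁ × ¬ SameEdge u v x₂ y₂

    -- The expander estimate concerns a single set moved by both permutations, so the near
    -- invariance of S x₂ under τ is carried over to S x₁ along `w₀`. If `w₁` or `w₂` is even, there
    -- is an odd closed walk and identity labels suffice.
    deficiency-bound : Adj G x₁ y₁ → Adj G x₂ y₂ → ¬ SameEdge x₁ y₁ x₂ y₂ →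
      Star Without₂ y₁ x₁ → Star Without₂ y₂ x₂ → Star Without₂ x₁ x₂ →
      ∃ λ L → ∀ k δ → Colourable G (suc k) δ → suc k ≤ L * δ
    deficiency-bound e₁ e₂ ¬same w₁ w₂ w₀ with not^-parity (length w₁) | not^-parity (length w₂)
    ... | inj₁ (even , _) | _ with parity-even⇒odd-closed G proj₁ e₁ w₁ even
    ...   | w , odd = length w , λ k δ → odd-closed-walk G w odd
    deficiency-bound e₁ e₂ ¬same w₁ w₂ w₀ | inj₂ _ | inj₁ (even , _) with parity-even⇒odd-closed G proj₁ e₂ w₂ even
    ...   | w , odd = length w , λ k δ → odd-closed-walk G w odd
    deficiency-bound e₁ e₂ ¬same w₁ w₂ w₀ | inj₂ (_ , odd₁) | inj₂ (_ , odd₂) = 24 + 16 * L , bound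
      where
      ℓ₀ = length w₀
      ℓ₁ = length w₁
      ℓ₂ = length w₂
      -- Going round through the first edge costs `suc ℓ₁` errors. The second round costs `suc ℓ₂`
      -- and uses `w₀` twice, to reach x₂ and to return.
      L = suc ℓ₁ + (ℓ₀ + suc ℓ₂ + ℓ₀)

      module _ {k δ : ℕ} (S : V → Subset k) (σ τ : Permutation′ k)
        (near₁ : distance (lookup (S x₁)) (not ∘ lookup (S y₁) ∘ (σ ⟨$⟩ʳ_)) ≤ δ)
        (near₂ : distance (lookup (S x₂)) (not ∘ lookup (S y₂) ∘ (τ ⟨$⟩ʳ_)) ≤ δ)
        (near  : ∀ {u v} → Without₂ u v → distance (lookup (S u)) (not ∘ lookup (S v)) ≤ δ)
        where
        open ≤-Reasoning
        A₁ = lookup (S x₁)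
        A₂ = lookup (S x₂)
        Ã₂ = not^ ℓ₀ ∘ A₂

        distance-σ : distance A₁ (A₁ ∘ (σ ⟨$⟩ʳ_)) ≤ suc ℓ₁ * δ
        distance-σ = distance-holonomy G A₁ (lookup (S y₁)) σ ℓ₁ odd₁ near₁ (distance-walk (lookup ∘ S) near w₁)

        distance-not^ : ∀ ℓ (A B : Fin k → Bool) → distance (not^ ℓ ∘ A) (not^ ℓ ∘ B) ≡ distance A B
        distance-not^ zero    A B = refl
        distance-not^ (suc ℓ) A B = trans (distance-not (not^ ℓ ∘ A) (not^ ℓ ∘ B)) (distance-not^ ℓ A B)

        distance-τ : distance A₁ (A₁ ∘ (τ ⟨$⟩ʳ_)) ≤ (ℓ₀ + suc ℓ₂ + ℓ₀) * δ
        distance-τ = begin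
          distance A₁ (A₁ ∘ (τ ⟨$⟩ʳ_))
            ≤⟨ distance-triangle A₁ (Ã₂ ∘ (τ ⟨$⟩ʳ_)) (A₁ ∘ (τ ⟨$⟩ʳ_)) ⟩
          distance A₁ (Ã₂ ∘ (τ ⟨$⟩ʳ_)) + distance (Ã₂ ∘ (τ ⟨$⟩ʳ_)) (A₁ ∘ (τ ⟨$⟩ʳ_))
            ≤⟨ +-mono-≤ (distance-triangle A₁ Ã₂ (Ã₂ ∘ (τ ⟨$⟩ʳ_))) (≤-reflexive (trans (distance-permute Ã₂ A₁ τ) (distance-sym Ã₂ A₁))) ⟩
          distance A₁ Ã₂ + distance Ã₂ (Ã₂ ∘ (τ ⟨$⟩ʳ_)) + distance A₁ Ã₂
            ≤⟨ +-mono-≤ (+-mono-≤ walk₀ (≤-trans (≤-reflexive (distance-not^ ℓ₀ A₂ (A₂ ∘ (τ ⟨$⟩ʳ_))))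
                 (distance-holonomy G A₂ (lookup (S y₂)) τ ℓ₂ odd₂ near₂ (distance-walk (lookup ∘ S) near w₂)))) walk₀ ⟩
          ℓ₀ * δ + suc ℓ₂ * δ + ℓ₀ * δ
            ≡⟨ cong (_+ ℓ₀ * δ) (*-distribʳ-+ δ ℓ₀ (suc ℓ₂)) ⟨
          (ℓ₀ + suc ℓ₂) * δ + ℓ₀ * δ
            ≡⟨ *-distribʳ-+ δ (ℓ₀ + suc ℓ₂) ℓ₀ ⟨
          (ℓ₀ + suc ℓ₂ + ℓ₀) * δ ∎
          where
          walk₀ : distance A₁ Ã₂ ≤ ℓ₀ * δ
          walk₀ = distance-walk (lookup ∘ S) near w₀

        agreements-σ-τ : k + k ≤ agreements A₁ (A₁ ∘ (σ ⟨$⟩ʳ_)) + agreements A₁ (A₁ ∘ (τ ⟨$⟩ʳ_)) + L * δ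
        agreements-σ-τ = begin
          k + k
            ≡⟨ cong₂ _+_ (agreements+distance A₁ (A₁ ∘ (σ ⟨$⟩ʳ_))) (agreements+distance A₁ (A₁ ∘ (τ ⟨$⟩ʳ_))) ⟨
          (gσ + distance A₁ (A₁ ∘ (σ ⟨$⟩ʳ_))) + (gτ + distance A₁ (A₁ ∘ (τ ⟨$⟩ʳ_)))
            ≤⟨ +-mono-≤ (+-monoʳ-≤ gσ distance-σ) (+-monoʳ-≤ gτ distance-τ) ⟩
          (gσ + suc ℓ₁ * δ) + (gτ + (ℓ₀ + suc ℓ₂ + ℓ₀) * δ)
            ≡⟨ solve 4 (λ a b c d → (a :+ b) :+ (c :+ d) := a :+ c :+ (b :+ d)) refl gσ (suc ℓ₁ * δ) gτ ((ℓ₀ + suc ℓ₂ + ℓ₀) * δ) ⟩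
          gσ + gτ + (suc ℓ₁ * δ + (ℓ₀ + suc ℓ₂ + ℓ₀) * δ)
            ≡⟨ cong (gσ + gτ +_) (*-distribʳ-+ δ (suc ℓ₁) (ℓ₀ + suc ℓ₂ + ℓ₀)) ⟨
          gσ + gτ + L * δ ∎
          where
          open +-*-Solver
          gσ = agreements A₁ (A₁ ∘ (σ ⟨$⟩ʳ_))
          gτ = agreements A₁ (A₁ ∘ (τ ⟨$⟩ʳ_))

      x₁≢y₁ : x₁ ≢ y₁
      x₁≢y₁ refl = Adj-irrefl G e₁
      x₂≢y₂ : x₂ ≢ y₂
      x₂≢y₂ refl = Adj-irrefl G e₂

      bound⁺ : ∀ k δ → Colourable G k (suc δ) → k ≤ (24 + 16 * L) * suc δ
      -- As τ precedes the colouring, m must be a size that every admissible colouring guarantees.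
      -- It bounds S x₁ from below directly, and also the complement of S x₁, which contains the
      -- relabelled copy of S y₁.
      bound⁺ k δ col with ∃-expander k ⌊ k ∸ suc δ /2⌋
      ... | τ , expanding = main (col (labelledCover G ℒ₂))
        where
        ℒ₁ = relabel G x₁ y₁ x₁≢y₁ rotate (identityLabelling G)
        ℒ₂ = relabel G x₂ y₂ x₂≢y₂ τ ℒ₁
        m = ⌊ k ∸ suc δ /2⌋

        main : (Σ (V → Subset k) λ S → QuasiIndependent (labelledCover G ℒ₂) S × (∀ u → k ≤ 2 * ∣ S u ∣ + suc δ)) → k ≤ (24 + 16 * L) * suc δ
        main (S , qi , large) = deficiency-arithmetic k δ L m (x≤1+2*⌊x/2⌋ (k ∸ suc δ)) (expanding (S x₁) (L * suc δ) m≤A m≤notA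
            (agreements-σ-τ S rotate τ near₁ near₂ near))
          where
          near′ : ∀ {u v} → Adj G u v → distance (lookup (S u)) (not ∘ lookup (S v) ∘ (proj₁ ℒ₂ u v ⟨$⟩ʳ_)) ≤ suc δ
          near′ = distance-labelled G ℒ₂ S qi large
          near-label : ∀ {u v π} → Adj G u v → proj₁ ℒ₂ u v ≡ π → distance (lookup (S u)) (not ∘ lookup (S v) ∘ (π ⟨$⟩ʳ_)) ≤ suc δ
          near-label uv refl = near′ uv
          near₁ : distance (lookup (S x₁)) (not ∘ lookup (S y₁) ∘ (rotate ⟨$⟩ʳ_)) ≤ suc δ
          near₁ = near-label e₁ (trans (relabel-away G x₂ y₂ x₂≢y₂ τ ℒ₁ ¬same) (relabel-at G x₁ y₁ x₁≢y₁ rotate (identityLabelling G)))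
          near₂ : distance (lookup (S x₂)) (not ∘ lookup (S y₂) ∘ (τ ⟨$⟩ʳ_)) ≤ suc δ
          near₂ = near-label e₂ (relabel-at G x₂ y₂ x₂≢y₂ τ ℒ₁)
          near : ∀ {u v} → Without₂ u v → distance (lookup (S u)) (not ∘ lookup (S v)) ≤ suc δ
          near (uv , ¬₁ , ¬₂) = near-label uv (trans (relabel-away G x₂ y₂ x₂≢y₂ τ ℒ₁ ¬₂) (relabel-away G x₁ y₁ x₁≢y₁ rotate (identityLabelling G) ¬₁))

          A B : Fin k → Bool
          A = lookup (S x₁)
          B = lookup (S y₁) ∘ (proj₁ ℒ₂ x₁ y₁ ⟨$⟩ʳ_)
          large-A : k ≤ 2 * size A + suc δ
          large-A = subst (λ s → k ≤ 2 * s + suc δ) (∣∣≡size (S x₁)) (large x₁)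
          large-B : k ≤ 2 * size B + suc δ
          large-B = subst (λ s → k ≤ 2 * s + suc δ) (trans (∣∣≡size (S y₁)) (∑-permute (χ ∘ lookup (S y₁)) (proj₁ ℒ₂ x₁ y₁))) (large y₁)
          B≤notA : size B ≤ size (not ∘ A)
          B≤notA = sum-mono-≤ λ i → pointwise (A i) (B i) (disjoint-labelled G ℒ₂ S qi e₁ i)
            where
            pointwise : ∀ a b → (a ≡ true → b ≡ true → ⊥) → χ b ≤ χ (not a)
            pointwise true  true  h = contradiction refl (h refl)
            pointwise true  false h = z≤n
            pointwise false true  h = ≤-refl
            pointwise false false h = z≤n
          m≤ : ∀ {s} → k ≤ 2 * s + suc δ → m ≤ s
          m≤ {s} h = ≤-trans (⌊n/2⌋-mono (m≤n+o⇒m∸n≤o k (suc δ) (subst (k ≤_) (+-comm (2 * s) (suc δ)) h)))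
            (≤-reflexive (trans (cong ⌊_/2⌋ (cong (s +_) (+-identityʳ s))) (sym (n≡⌊n+n/2⌋ s))))
          m≤A = m≤ large-A
          m≤notA = ≤-trans (m≤ large-B) B≤notA

      bound : ∀ k δ → Colourable G (suc k) δ → suc k ≤ (24 + 16 * L) * δ
      -- For δ = 0 additive constants cannot be absorbed into a multiple of δ, so halves are
      -- excluded separately.
      bound k zero    col = contradiction col (¬exactly-half G e₁ (Star.map (λ (uv , ¬₁ , _) → uv , ¬₁) w₁))
      bound k (suc δ) col = bound⁺ (suc k) δ col

-- Walks around cycles and detours

module Cycles where

  open Labellings
  open import Data.Nat
  open import Data.Nat.Properties
  open import Relation.Binary.Construct.Closure.ReflexiveTransitive as Star using (Star; ε; _◅_; _◅◅_; _⋆)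

  module _ {V : Set} {R : V → V → Set} where

    walk-from-start : ∀ {m} (f : Fin (suc m) → V) i → (∀ (j : Fin m) → toℕ j < toℕ i → R (f (inject₁ j)) (f (suc j))) →
      Σ (Star R (f zero) (f i)) λ w → length w ≡ toℕ i
    walk-from-start f zero h = ε , refl
    walk-from-start {suc m} f (suc i) h with walk-from-start (f ∘ suc) i (λ j lt → h (suc j) (s≤s lt))
    ... | w , e = h zero (s≤s z≤n) ◅ w , cong suc e

    walk-to-end : ∀ {m} (f : Fin (suc m) → V) i → (∀ (j : Fin m) → toℕ i ≤ toℕ j → R (f (inject₁ j)) (f (suc j))) →
      Star R (f i) (f (fromℕ m))
    walk-to-end {m} f zero h = proj₁ (walk-from-start f (fromℕ m) λ j _ → h j z≤n)
    walk-to-end {suc m} f (suc i) h = walk-to-end (f ∘ suc) i (λ j le → h (suc j) (s≤s le))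

  SameEdge-swap : ∀ {n} {u v x y : Fin n} → SameEdge u v x y → SameEdge v u x y
  SameEdge-swap (inj₁ (p , q)) = inj₂ (q , p)
  SameEdge-swap (inj₂ (p , q)) = inj₁ (q , p)

  SameEdge-flip : ∀ {n} {u v x y : Fin n} → SameEdge u v x y → SameEdge u v y x
  SameEdge-flip (inj₁ p) = inj₂ p
  SameEdge-flip (inj₂ p) = inj₁ p

  module _ {G : Graph} where

    private V = Fin (order G)

    CycEdge-sym : ∀ {c : Cycle G} {u v} → CycEdge c u v → CycEdge c v u
    CycEdge-sym (inj₁ (i , inj₁ p)) = inj₁ (i , inj₂ p)
    CycEdge-sym (inj₁ (i , inj₂ p)) = inj₁ (i , inj₁ p)
    CycEdge-sym (inj₂ (inj₁ p))     = inj₂ (inj₂ p)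
    CycEdge-sym (inj₂ (inj₂ p))     = inj₂ (inj₁ p)

    CycEdge⇒Adj : (c : Cycle G) → ∀ {u v} → CycEdge c u v → Adj G u v
    CycEdge⇒Adj c (inj₁ (i , inj₁ (refl , refl))) = path c i
    CycEdge⇒Adj c (inj₁ (i , inj₂ (refl , refl))) = Adj-sym G (path c i)
    CycEdge⇒Adj c (inj₂ (inj₁ (refl , refl)))     = closing c
    CycEdge⇒Adj c (inj₂ (inj₂ (refl , refl)))     = Adj-sym G (closing c)

    CycEdge? : (c : Cycle G) → ∀ u v → Dec (CycEdge c u v)
    CycEdge? c u v = F.any? (λ i → sameEdge?′ (vs c (inject₁ i)) (vs c (suc i))) ⊎-dec sameEdge?′ (vs c (fromℕ (m' c))) (vs c zero)
      where
      sameEdge?′ : ∀ a b → Dec ((a ≡ u × b ≡ v) ⊎ (a ≡ v × b ≡ u))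
      sameEdge?′ a b = sameEdge? a b u v

    module _ (c : Cycle G) where

      private
        last : Fin (suc (m' c))
        last = fromℕ (m' c)

      CycEdgeExcept : (x y u v : V) → Set
      CycEdgeExcept x y u v = CycEdge c u v × ¬ SameEdge u v x y

      closing-distinct : ∀ i → ¬ SameEdge (vs c last) (vs c zero) (vs c (inject₁ i)) (vs c (suc i))
      closing-distinct i (inj₁ (p , _)) = F.fromℕ≢inject₁ (inj c p)
      -- The closing edge could only be a path edge reversed if m' were 1, which `long` forbids.
      closing-distinct i (inj₂ (p , q)) = contradiction (long c) (<⇒≱ (s≤s (≤-reflexive (begin
        m' c               ≡⟨ F.toℕ-fromℕ (m' c) ⟨
        toℕ last           ≡⟨ cong toℕ (inj c p) ⟩
        suc (toℕ i)        ≡⟨ cong suc (F.toℕ-inject₁ i) ⟨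
        suc (toℕ (inject₁ i)) ≡⟨ cong (suc ∘ toℕ) (inj c q) ⟨
        1                  ∎))))
        where open ≡-Reasoning

      path-distinct : ∀ {i j} → i ≢ j → ¬ SameEdge (vs c (inject₁ i)) (vs c (suc i)) (vs c (inject₁ j)) (vs c (suc j))
      path-distinct i≢j (inj₁ (p , _)) = i≢j (F.inject₁-injective (inj c p))
      path-distinct {i} {j} i≢j (inj₂ (p , q)) = m≢1+n+m (toℕ i) {1} (begin
        toℕ i                  ≡⟨ F.toℕ-inject₁ i ⟨
        toℕ (inject₁ i)        ≡⟨ cong toℕ (inj c p) ⟩
        suc (toℕ j)            ≡⟨ cong suc (F.toℕ-inject₁ j) ⟨
        suc (toℕ (inject₁ j))  ≡⟨ cong (suc ∘ toℕ) (inj c q) ⟨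
        2 + toℕ i              ∎)
        where open ≡-Reasoning

      SameEdge-sym : ∀ {u v x y : V} → SameEdge u v x y → SameEdge x y u v
      SameEdge-sym (inj₁ (refl , refl)) = inj₁ (refl , refl)
      SameEdge-sym (inj₂ (refl , refl)) = inj₂ (refl , refl)

      walk-around-closing : Σ (Star (CycEdgeExcept (vs c last) (vs c zero)) (vs c zero) (vs c last)) λ w → length w ≡ m' c
      walk-around-closing with walk-from-start (vs c) last (λ j _ → inj₁ (j , inj₁ (refl , refl)) , closing-distinct j ∘ SameEdge-sym)
      ... | w , e = w , trans e (F.toℕ-fromℕ (m' c))

      CycEdgeExcept-sym : ∀ {x y u v} → CycEdgeExcept x y u v → CycEdgeExcept x y v u
      CycEdgeExcept-sym (e , ¬same) = CycEdge-sym {c} e , ¬same ∘ SameEdge-swap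

      walk-around-path : ∀ i → Star (CycEdgeExcept (vs c (inject₁ i)) (vs c (suc i))) (vs c (suc i)) (vs c (inject₁ i))
      walk-around-path i =
        walk-to-end (vs c) (suc i) (λ j i<j → on-path j λ { refl → <-irrefl refl i<j })
        ◅◅ (inj₂ (inj₁ (refl , refl)) , closing-distinct i)
        ◅ proj₁ (walk-from-start (vs c) (inject₁ i) λ j j<i → on-path j λ { refl → <-irrefl (sym (F.toℕ-inject₁ j)) j<i })
        where
        on-path : ∀ j → j ≢ i → CycEdgeExcept (vs c (inject₁ i)) (vs c (suc i)) (vs c (inject₁ j)) (vs c (suc j))
        on-path j j≢i = inj₁ (j , inj₁ (refl , refl)) , path-distinct j≢i

      walk-around : ∀ {x y} → CycEdge c x y → Star (CycEdgeExcept x y) y x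
      walk-around (inj₁ (i , inj₁ (refl , refl))) = walk-around-path i
      walk-around (inj₁ (i , inj₂ (refl , refl))) = Star.map (λ (e , ¬same) → e , ¬same ∘ SameEdge-flip) (Star.reverse CycEdgeExcept-sym (walk-around-path i))
      walk-around (inj₂ (inj₁ (refl , refl)))     = proj₁ walk-around-closing
      walk-around (inj₂ (inj₂ (refl , refl)))     = Star.map (λ (e , ¬same) → e , ¬same ∘ SameEdge-flip) (Star.reverse CycEdgeExcept-sym (proj₁ walk-around-closing))

      cycle-closed-walk : Σ (Star (Adj G) (vs c last) (vs c last)) λ w → length w ≡ cycLength c
      cycle-closed-walk with walk-from-start {R = Adj G} (vs c) last (λ j _ → path c j)
      ... | w , e = closing c ◅ w , cong suc (trans e (F.toℕ-fromℕ (m' c)))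

      odd-cycle-deficiency : OddCycle c → ∀ {k δ} → Colourable G k δ → k ≤ cycLength c * δ
      odd-cycle-deficiency odd {k} {δ} col with cycle-closed-walk
      ... | w , e = subst (λ ℓ → k ≤ ℓ * δ) e (odd-closed-walk G w (odd ∘ subst (2 ∣_) e) col)

      cycle⇒¬exactly-half : ∀ {k} → ¬ Colourable G (suc k) 0
      cycle⇒¬exactly-half = ¬exactly-half G (closing c)
        (Star.map (λ (e , ¬same) → CycEdge⇒Adj c e , ¬same) (proj₁ walk-around-closing))

    Walk⇒Star : ∀ {u v} → Walk G u v → Star (Adj G) u v
    Walk⇒Star here       = ε
    Walk⇒Star (step e w) = e ◅ Walk⇒Star w

    reroute : ∀ {R R′ : V → V → Set} x y → (∀ {u v} → R u v → ¬ SameEdge u v x y → R′ u v) → Star R′ x y → Star R′ y x →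
      ∀ {u v} → Star R u v → Star R′ u v
    reroute {R} {R′} x y keep there back = bypass ⋆
      where
      bypass : ∀ {u v} → R u v → Star R′ u v
      bypass {u} {v} r with sameEdge? u v x y
      ... | yes (inj₁ (refl , refl)) = there
      ... | yes (inj₂ (refl , refl)) = back
      ... | no ¬same                 = keep r ¬same ◅ ε

    -- Removing xy keeps the graph connected by way of c; removing the closing edge of d keeps it so
    -- by way of the rest of d, which avoids xy. The order matters: the detour along c may use the
    -- closing edge of d and is itself rerouted in the second stage.
    distinct-cycles-deficiency : Connected G → (c d : Cycle G) → ∀ {x y} → CycEdge c x y → ¬ CycEdge d x y →
      ∃ λ L → ∀ k δ → Colourable G (suc k) δ → suc k ≤ L * δ
    distinct-cycles-deficiency (_ , walk) c d {x} {y} xy∈c xy∉d =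
      deficiency-bound G (CycEdge⇒Adj c xy∈c) (closing d) (λ same → xy∉d (inj₂ ([ (λ (p , q) → inj₁ (sym p , sym q)) , (λ (p , q) → inj₂ (sym q , sym p)) ]′ same)))
        (remove₂ y x) forth (remove₂ x (vs d (fromℕ (m' d))))
      where
      R₁ = Without G {x} {y}
      R₂ = Without₂ G {x} {y} {vs d (fromℕ (m' d))} {vs d zero}

      R₂-sym : ∀ {u v} → R₂ u v → R₂ v u
      R₂-sym (e , ¬₁ , ¬₂) = Adj-sym G e , ¬₁ ∘ SameEdge-swap , ¬₂ ∘ SameEdge-swap

      d-avoids-xy : ∀ {u v} → CycEdge d u v → ¬ SameEdge u v x y
      d-avoids-xy e (inj₁ (refl , refl)) = xy∉d e
      d-avoids-xy e (inj₂ (refl , refl)) = xy∉d (CycEdge-sym {d} e)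

      forth : Star R₂ (vs d zero) (vs d (fromℕ (m' d)))
      forth = Star.map (λ (e , ¬same) → CycEdge⇒Adj d e , d-avoids-xy e , ¬same) (proj₁ (walk-around-closing d))

      around-c : Star R₁ y x
      around-c = Star.map (λ (e , ¬same) → CycEdge⇒Adj c e , ¬same) (walk-around c xy∈c)

      R₁-sym : ∀ {u v} → R₁ u v → R₁ v u
      R₁-sym (e , ¬same) = Adj-sym G e , ¬same ∘ SameEdge-swap

      remove₁ : ∀ u v → Star R₁ u v
      remove₁ u v = reroute x y _,_ (Star.reverse R₁-sym around-c) around-c (Walk⇒Star (walk u v))

      remove₂ : ∀ u v → Star R₂ u v
      remove₂ u v = reroute (vs d (fromℕ (m' d))) (vs d zero) (λ (e , ¬₁) ¬₂ → e , ¬₁ , ¬₂) (Star.reverse R₂-sym forth) forth (remove₁ u v)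

-- Completing matchings and choosing nearly closed sets

module Colouring where

  open Mixing
  open Labellings
  open Cycles
  open import Data.Nat
  open import Data.Nat.Properties
  open import Data.List using (List; []; _∷_)
  open import Data.List.Membership.Propositional using (_∈_; _∉_)
  open import Data.List.Relation.Unary.Any using (here; there)
  open import Algebra.Properties.CommutativeMonoid.Sum +-0-commutativeMonoid

  private variable k : ℕ

  -- Send `zero` to its partner or, failing that, to a point that no other row uses. If all points
  -- were used, choosing a row for each would inject `suc n` points into n rows.
  extend-matching : ∀ n (M : Fin n → Fin n → Bool) →
    (∀ i j j′ → M i j ≡ true → M i j′ ≡ true → j ≡ j′) → (∀ i i′ j → M i j ≡ true → M i′ j ≡ true → i ≡ i′) →
    ∃ λ (π : Permutation′ n) → ∀ i j → M i j ≡ true → π ⟨$⟩ʳ i ≡ j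
  extend-matching zero    M fun inj = P.id , λ ()
  extend-matching (suc n) M fun inj = insert zero j₀ π , agrees
    where
    image : Σ (Fin (suc n)) λ j₀ → (∀ j → M zero j ≡ true → j ≡ j₀) × (∀ i → M (suc i) j₀ ≢ true)
    image with F.any? (λ j → M zero j B.≟ true)
    ... | yes (j₀ , e) = j₀ , (λ j e′ → fun zero j j₀ e′ e) , λ i e′ → F.0≢1+n (inj zero (suc i) j₀ e e′)
    ... | no none with F.any? (λ j → ¬? (F.any? λ i → M (suc i) j B.≟ true))
    ...   | yes (j₀ , free) = j₀ , (λ j e → contradiction (j , e) none) , λ i e → free (i , e)
    ...   | no ¬free = contradiction (F.injective⇒≤ {f = proj₁ ∘ hit} injective) (<⇒≱ ≤-refl)
      where
      hit : ∀ j → ∃ λ i → M (suc i) j ≡ true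
      hit j = decidable-stable (F.any? λ i → M (suc i) j B.≟ true) λ ¬hit → ¬free (j , ¬hit)
      injective : Injective _≡_ _≡_ (proj₁ ∘ hit)
      injective {j} {j′} e = fun (suc (proj₁ (hit j))) j j′ (proj₂ (hit j)) (subst (λ i → M (suc i) j′ ≡ true) (sym e) (proj₂ (hit j′)))
    j₀ = proj₁ image
    rest = extend-matching n (λ i j → M (suc i) (punchIn j₀ j))
      (λ i j j′ e e′ → F.punchIn-injective j₀ j j′ (fun (suc i) _ _ e e′))
      (λ i i′ j e e′ → F.suc-injective (inj (suc i) (suc i′) _ e e′))
    π = proj₁ rest
    agrees : ∀ i j → M i j ≡ true → insert zero j₀ π ⟨$⟩ʳ i ≡ j
    agrees zero    j e = sym (proj₁ (proj₂ image) j e)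
    agrees (suc i) j e = trans (cong (punchIn j₀) (proj₂ rest i (punchOut j₀≢j) (subst (λ x → M (suc i) x ≡ true) (sym (F.punchIn-punchOut j₀≢j)) e)))
                               (F.punchIn-punchOut j₀≢j)
      where
      j₀≢j : j₀ ≢ j
      j₀≢j refl = proj₂ (proj₂ image) i e

  add : Fin k → (Fin k → Bool) → Fin k → Bool
  add x A i = if does (i F.≟ x) then true else A i

  add-new : ∀ (x : Fin k) A → add x A x ≡ true
  add-new x A with x F.≟ x
  ... | yes _ = refl
  ... | no ¬e = contradiction refl ¬e

  add-old : ∀ (x : Fin k) A i → A i ≡ true → add x A i ≡ true
  add-old x A i e with i F.≟ x
  ... | yes _ = refl
  ... | no _  = e

  add-cases : ∀ (x : Fin k) A i → add x A i ≡ true → i ≡ x ⊎ A i ≡ true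
  add-cases x A i e with i F.≟ x
  ... | yes i≡x = inj₁ i≡x
  ... | no _    = inj₂ e

  size-add : ∀ (x : Fin k) A → χ (A x) + size (add x A) ≡ suc (size A)
  size-add {suc k} x A = begin
    χ (A x) + size (add x A)
      ≡⟨ cong (χ (A x) +_) (sum-remove {i = x} (χ ∘ add x A)) ⟩
    χ (A x) + (χ (add x A x) + sum (χ ∘ add x A ∘ punchIn x))
      ≡⟨ cong₂ (λ a b → χ (A x) + (χ a + b)) (add-new x A) (sum-cong-≗ λ j → cong χ (away j)) ⟩
    χ (A x) + suc (sum (χ ∘ A ∘ punchIn x))
      ≡⟨ +-suc (χ (A x)) _ ⟩
    suc (χ (A x) + sum (χ ∘ A ∘ punchIn x))
      ≡⟨ cong suc (sum-remove {i = x} (χ ∘ A)) ⟨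
    suc (size A) ∎
    where
    open ≡-Reasoning
    away : ∀ j → add x A (punchIn x j) ≡ A (punchIn x j)
    away j with punchIn x j F.≟ x
    ... | yes e = contradiction e (F.punchInᵢ≢i x j)
    ... | no _  = refl

  size-add-≤ : ∀ (x : Fin k) A → size (add x A) ≤ suc (size A)
  size-add-≤ x A = ≤-trans (m≤n+m _ (χ (A x))) (≤-reflexive (size-add x A))

  size-add-new : ∀ (x : Fin k) A → A x ≡ false → size (add x A) ≡ suc (size A)
  size-add-new x A e = trans (cong (λ b → χ b + size (add x A)) (sym e)) (size-add x A)

  ∃-outside : (A : Fin k → Bool) → size A < k → ∃ λ x → A x ≡ false
  ∃-outside {k} A small with F.any? (λ x → A x B.≟ false)
  ... | yes p = p
  ... | no ¬p = contradiction small (≤⇒≯ (≤-reflexive (begin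
    k                     ≡⟨ trans (sum-const k 1) (*-identityʳ k) ⟨
    sum {k} (λ _ → 1)     ≡⟨ sum-cong-≗ (λ x → cong χ (B.¬-not {A x} {false} λ e → ¬p (x , e))) ⟨
    size A                ∎)))
    where open ≡-Reasoning

  -- New elements of A are taken from U outside A whenever possible, so U exceeds A by at most one element.
  nearly-closed : (ρ : Fin k → Fin k) → ∀ s → s ≤ k → Σ ((Fin k → Bool) × (Fin k → Bool)) λ (A , U) →
    size A ≡ s × size U ≤ suc s × (∀ i → A i ≡ true → U i ≡ true × U (ρ i) ≡ true)
  nearly-closed {k} ρ zero    _ = ((λ _ → false) , λ _ → false) , empty , ≤-trans (≤-reflexive empty) z≤n , λ _ ()
    where
    empty : size {k} (λ _ → false) ≡ 0
    empty = trans (sum-const k 0) (*-zeroʳ k)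
  nearly-closed {k} ρ (suc s) s<k with nearly-closed ρ s (<⇒≤ s<k)
  ... | (A , U) , refl , U≤ , closed with F.any? (λ x → (U x B.≟ true) ×-dec (A x B.≟ false))
  ...   | yes (x , Ux , Ax) = (add x A , add (ρ x) U) , size-add-new x A Ax , ≤-trans (size-add-≤ (ρ x) U) (s≤s U≤) , closed′
    where
    closed′ : ∀ i → add x A i ≡ true → add (ρ x) U i ≡ true × add (ρ x) U (ρ i) ≡ true
    closed′ i e with add-cases x A i e
    ... | inj₁ refl = add-old (ρ x) U x Ux , add-new (ρ x) U
    ... | inj₂ Ai   = add-old (ρ x) U i (proj₁ (closed i Ai)) , add-old (ρ x) U (ρ i) (proj₂ (closed i Ai))
  ...   | no U⊆A with ∃-outside A s<k
  ...     | x , Ax = (add x A , add (ρ x) (add x U)) , size-add-new x A Ax , ≤-trans (size-add-≤ (ρ x) (add x U)) (s≤s (≤-trans (size-add-≤ x U) (s≤s U≤A))) , closed′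
    where
    U≤A : size U ≤ size A
    U≤A = sum-mono-≤ λ i → pointwise (A i) (U i) λ u a → U⊆A (i , u , a)
      where
      pointwise : ∀ a u → (u ≡ true → a ≡ false → ⊥) → χ u ≤ χ a
      pointwise true  true  h = ≤-refl
      pointwise true  false h = z≤n
      pointwise false true  h = contradiction refl (h refl)
      pointwise false false h = z≤n
    closed′ : ∀ i → add x A i ≡ true → add (ρ x) (add x U) i ≡ true × add (ρ x) (add x U) (ρ i) ≡ true
    closed′ i e with add-cases x A i e
    ... | inj₁ refl = add-old (ρ x) (add x U) x (add-new x U) , add-new (ρ x) (add x U)
    ... | inj₂ Ai   = add-old (ρ x) (add x U) i (add-old x U i (proj₁ (closed i Ai))) , add-old (ρ x) (add x U) (ρ i) (add-old x U (ρ i) (proj₂ (closed i Ai)))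

  -- Trees, trivialisation of covers and the near-half colouring

  module _ (G : Graph) where

    private V = Fin (order G)

    data Tree : List V → Set where
      root : ∀ r → Tree (r ∷ [])
      grow : ∀ {R w r} → Tree R → w ∉ R → r ∈ R → Adj G r w → Tree (w ∷ R)

    TreeEdge : ∀ {R} → Tree R → V → V → Set
    TreeEdge (root _)                       u v = ⊥
    TreeEdge (grow {w = w} {r = r} t _ _ _) u v = SameEdge u v w r ⊎ TreeEdge t u v

    TreeEdge? : ∀ {R} (t : Tree R) u v → Dec (TreeEdge t u v)
    TreeEdge? (root _)                       u v = no λ ()
    TreeEdge? (grow {w = w} {r = r} t _ _ _) u v = sameEdge? u v w r ⊎-dec TreeEdge? t u v

    TreeEdge-sym : ∀ {R} (t : Tree R) {u v} → TreeEdge t u v → TreeEdge t v u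
    TreeEdge-sym (grow t _ _ _) (inj₁ same) = inj₁ (SameEdge-swap same)
    TreeEdge-sym (grow t _ _ _) (inj₂ e)    = inj₂ (TreeEdge-sym t e)

    TreeEdge⇒∈ : ∀ {R} (t : Tree R) {u v} → TreeEdge t u v → u ∈ R
    TreeEdge⇒∈ (grow t _ r∈R _) (inj₁ (inj₁ (refl , _))) = here refl
    TreeEdge⇒∈ (grow t _ r∈R _) (inj₁ (inj₂ (refl , _))) = there r∈R
    TreeEdge⇒∈ (grow t _ _ _)   (inj₂ e)                 = there (TreeEdge⇒∈ t e)

    TreeEdge⇒Adj : ∀ {R} (t : Tree R) {u v} → TreeEdge t u v → Adj G u v
    TreeEdge⇒Adj (grow t _ _ e) (inj₁ (inj₁ (refl , refl))) = Adj-sym G e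
    TreeEdge⇒Adj (grow t _ _ e) (inj₁ (inj₂ (refl , refl))) = e
    TreeEdge⇒Adj (grow t _ _ _) (inj₂ e)                    = TreeEdge⇒Adj t e

    -- Both the bipartition and the trivialisation of a cover arise by propagating values from parents to new vertices.
    along : ∀ {X : Set} {R} → X → (V → V → X → X) → Tree R → V → X
    along z f (root _) v = z
    along z f (grow {w = w} {r = r} t _ _ _) v with v F.≟ w
    ... | yes _ = f w r (along z f t r)
    ... | no _  = along z f t v

    -- The new vertex w is not in R, so the values on the old tree persist and only the edge from w
    -- to its parent remains to be checked.
    along-edge : ∀ {X : Set} {R} z (f : V → V → X → X) (Q : V → V → X → X → Set) →
      (∀ {u v a b} → Q u v a b → Q v u b a) → (∀ w r a → Q w r (f w r a) a) →
      (t : Tree R) → ∀ {u v} → TreeEdge t u v → Q u v (along z f t u) (along z f t v)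
    along-edge z f Q Q-sym Q-f (grow {w = w} {r = r} t w∉R r∈R rw) = edge
      where
      t⁺ = grow t w∉R r∈R rw
      at-r : ∀ {v} → v ∈ _ → along z f t⁺ v ≡ along z f t v
      at-r {v} v∈R with v F.≟ w
      ... | yes refl = contradiction v∈R w∉R
      ... | no _     = refl
      at-w : along z f t⁺ w ≡ f w r (along z f t r)
      at-w with w F.≟ w
      ... | yes _ = refl
      ... | no ¬e = contradiction refl ¬e
      wr : Q w r (along z f t⁺ w) (along z f t⁺ r)
      wr = subst₂ (Q w r) (sym at-w) (sym (at-r r∈R)) (Q-f w r _)
      edge : ∀ {u v} → TreeEdge t⁺ u v → Q u v (along z f t⁺ u) (along z f t⁺ v)
      edge (inj₁ (inj₁ (refl , refl))) = wr
      edge (inj₁ (inj₂ (refl , refl))) = Q-sym wr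
      edge (inj₂ e) = subst₂ (Q _ _) (sym (at-r (TreeEdge⇒∈ t e))) (sym (at-r (TreeEdge⇒∈ t (TreeEdge-sym t e)))) (along-edge z f Q Q-sym Q-f t e)

    side : ∀ {R} → Tree R → V → Bool
    side = along true (λ _ _ → not)

    side-edge : ∀ {R} (t : Tree R) {u v} → TreeEdge t u v → side t u ≡ not (side t v)
    side-edge = along-edge true (λ _ _ → not) (λ _ _ a b → a ≡ not b) (λ {_} {_} {a} {b} e → trans (sym (B.not-involutive b)) (cong not (sym e))) (λ _ _ _ → refl)

    module _ (H : Cover G k) where

      transport : ∀ w r → ∃ λ (π : Permutation′ k) → ∀ i j → cross H w r i j ≡ true → π ⟨$⟩ʳ i ≡ j
      transport w r = extend-matching k (cross H w r) (matchingˡ H w r) (matchingʳ H w r)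

      -- Composing the transports up to the root reads every list in the coordinates of the root's
      -- list; there, cross-edges over tree edges join equal elements.
      gauge : ∀ {R} → Tree R → V → Permutation′ k
      gauge = along P.id λ w r π → proj₁ (transport w r) ∘ₚ π

      gauge-edge : ∀ {R} (t : Tree R) {u v} → TreeEdge t u v → ∀ i j → cross H u v i j ≡ true → gauge t u ⟨$⟩ʳ i ≡ gauge t v ⟨$⟩ʳ j
      gauge-edge = along-edge P.id _ (λ u v π π′ → ∀ i j → cross H u v i j ≡ true → π ⟨$⟩ʳ i ≡ π′ ⟨$⟩ʳ j)
        (λ {u} {v} h i j e → sym (h j i (trans (crossSym H u v j i) e)))
        (λ w r π i j e → cong (π ⟨$⟩ʳ_) (proj₂ (transport w r) i j e))

    module _ {j} (H : Cover G (suc (j + j))) (γ : V → Permutation′ (suc (j + j))) (s : V → Bool) {x y : V}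
      (spans : ∀ {u v i i′} → cross H u v i i′ ≡ true → (γ u ⟨$⟩ʳ i ≡ γ v ⟨$⟩ʳ i′ × s u ≡ not (s v)) ⊎ SameEdge u v x y)
      (crosses : ∀ {i i′} → cross H x y i i′ ≡ true → s x ≡ true × s y ≡ false) where

      -- A ⊆ U separates equal coordinates on opposite sides, and ρ(A) ⊆ U does the same over the
      -- exceptional edge. The element by which U may exceed A is the odd one of 2j + 1, so the
      -- complement of U still has j elements.
      near-half-colouring : Σ (V → Subset (suc (j + j))) λ S → QuasiIndependent H S × (∀ u → j ≤ ∣ S u ∣)
      near-half-colouring = S , independent , large
        where
        N = suc (j + j)
        g : V → Fin N → Fin N
        g u i = γ u ⟨$⟩ʳ i

        partner : ∀ i → Dec (∃ λ i′ → cross H x y i i′ ≡ true)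
        partner i = F.any? λ i′ → cross H x y i i′ B.≟ true

        ρ : Fin N → Fin N
        ρ a with partner (γ x ⟨$⟩ˡ a)
        ... | yes (i′ , _) = g y i′
        -- A point without partner imposes no constraint across xy, so any value would do.
        -- `nearly-closed` accepts an arbitrary map, hence the matching is not completed here.
        ... | no _         = a

        ρ-edge : ∀ i i′ → cross H x y i i′ ≡ true → ρ (g x i) ≡ g y i′
        ρ-edge i i′ e with partner (γ x ⟨$⟩ˡ g x i)
        ... | yes (i″ , e′) = cong (g y) (matchingˡ H x y i i″ i′ (subst (λ a → cross H x y a i″ ≡ true) (P.inverseˡ (γ x)) e′) e)
        ... | no none       = contradiction (i′ , subst (λ a → cross H x y a i′ ≡ true) (sym (P.inverseˡ (γ x))) e) none

        sets = nearly-closed ρ j (m≤n⇒m≤1+n (m≤m+n j j))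
        A U B : Fin N → Bool
        A = proj₁ (proj₁ sets)
        U = proj₂ (proj₁ sets)
        B = not ∘ U
        size-A : size A ≡ j
        size-A = proj₁ (proj₂ sets)
        closed : ∀ a → A a ≡ true → U a ≡ true × U (ρ a) ≡ true
        closed = proj₂ (proj₂ (proj₂ sets))
        size-B : j ≤ size B
        size-B = +-cancelˡ-≤ (suc j) _ _ (begin
          N                 ≡⟨ size+size-not U ⟨
          size U + size B   ≤⟨ +-monoˡ-≤ (size B) (proj₁ (proj₂ (proj₂ sets))) ⟩
          suc j + size B    ∎)
          where open ≤-Reasoning

        class : Bool → Fin N → Bool
        class true  = A
        class false = B

        S : V → Subset N
        S u = tabulate (class (s u) ∘ g u)

        large-class : ∀ b → j ≤ size (class b)
        large-class true  = ≤-reflexive (sym size-A)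
        large-class false = size-B

        large : ∀ u → j ≤ ∣ S u ∣
        large u = begin
          j                                ≤⟨ large-class (s u) ⟩
          size (class (s u))          ≡⟨ ∑-permute (χ ∘ class (s u)) (γ u) ⟩
          size (class (s u) ∘ g u)    ≡⟨ sum-cong-≗ (λ i → cong χ (lookup∘tabulate (class (s u) ∘ g u) i)) ⟨
          size (lookup (S u))              ≡⟨ ∣∣≡size (S u) ⟨
          ∣ S u ∣                          ∎
          where open ≤-Reasoning

        incompatible : ∀ a b → A a ≡ true → (b ≡ a ⊎ b ≡ ρ a) → B b ≡ true → ⊥
        incompatible a b Aa (inj₁ refl) Bb = contradiction (trans (sym Bb) (cong not (proj₁ (closed a Aa)))) λ ()
        incompatible a b Aa (inj₂ refl) Bb = contradiction (trans (sym Bb) (cong not (proj₂ (closed a Aa)))) λ ()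

        exceptional : ∀ i i′ → cross H x y i i′ ≡ true → class (s x) (g x i) ≡ true → class (s y) (g y i′) ≡ true → ⊥
        exceptional i i′ e p q with s x | s y | crosses e
        ... | true | false | _ = incompatible (g x i) (g y i′) p (inj₂ (sym (ρ-edge i i′ e))) q

        opposite-sides : ∀ a b → a ≡ not b → ∀ c → class a c ≡ true → class b c ≡ true → ⊥
        opposite-sides true  false _ c p q = incompatible c c p (inj₁ refl) q
        opposite-sides false true  _ c p q = incompatible c c q (inj₁ refl) p

        ∈-class : ∀ {u i} → S u [ i ]= true → class (s u) (g u i) ≡ true
        ∈-class {u} {i} i∈ = trans (sym (lookup∘tabulate (class (s u) ∘ g u) i)) ([]=⇒lookup i∈)

        independent : QuasiIndependent H S
        independent u v i i′ e p q with spans e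
        ... | inj₁ (same , opposite) = opposite-sides (s u) (s v) opposite (g u i) (∈-class p)
                                         (subst (λ c → class (s v) c ≡ true) (sym same) (∈-class q))
        ... | inj₂ (inj₁ (refl , refl)) = exceptional i i′ e (∈-class p) (∈-class q)
        ... | inj₂ (inj₂ (refl , refl)) = exceptional i′ i (trans (crossSym H x y i′ i) e) (∈-class q) (∈-class p)

-- Spanning trees and fundamental cycles

module Trees where

  open Labellings
  open Cycles
  open Colouring
  open import Data.Nat
  open import Data.Nat.Properties
  open import Data.List using (List; []; _∷_; allFin)
  import Data.List.Membership.DecPropositional as DecMembership
  open import Data.List.Membership.Propositional using (_∈_; _∉_)
  open import Data.List.Membership.Propositional.Properties using (∈-allFin)
  open import Data.List.Relation.Unary.Any using (here; there)

  module _ (G : Graph) where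

    private V = Fin (order G)

    open DecMembership {A = V} F._≟_ using (_∈?_)

    tree-along-walk : ∀ {R u v} → Tree G R → u ∈ R → Walk G u v → ∃ λ R′ → Tree G R′ × (∀ {w} → w ∈ R → w ∈ R′) × v ∈ R′
    tree-along-walk {R} t u∈R here = R , t , id , u∈R
    tree-along-walk {R} t u∈R (step {w = w} e walk) with w ∈? R
    ... | yes w∈R = tree-along-walk t w∈R walk
    ... | no  w∉R with tree-along-walk (grow t w∉R u∈R e) (here refl) walk
    ...   | R′ , t′ , R⊆R′ , v∈R′ = R′ , t′ , R⊆R′ ∘ there , v∈R′

    spanning-tree : Connected G → ∃ λ R → Tree G R × (∀ v → v ∈ R)
    spanning-tree (nonempty , walk) with reach-all (allFin (order G))
      where
      r : V
      r = F.fromℕ< (>-nonZero⁻¹ (order G) {{nonempty}})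
      reach-all : ∀ vs → ∃ λ R → Tree G R × r ∈ R × (∀ {v} → v ∈ vs → v ∈ R)
      reach-all []       = r ∷ [] , root r , here refl , λ ()
      reach-all (v ∷ vs) with reach-all vs
      ... | R , t , r∈R , vs⊆R with tree-along-walk t r∈R (walk r v)
      ...   | R′ , t′ , R⊆R′ , v∈R′ = R′ , t′ , R⊆R′ r∈R , λ { (here refl) → v∈R′ ; (there v∈vs) → R⊆R′ (vs⊆R v∈vs) }
    ... | R , t , _ , all = R , t , λ v → all (∈-allFin v)

    -- The shape follows `Cycle`, so that one closing edge makes a cycle. The field `within`
    -- confines the path to R, which keeps it simple when a vertex outside R is prepended.
    record SimplePath (E : V → V → Set) (R : List V) (u v : V) : Set where
      field
        len      : ℕ
        at       : Fin (suc len) → V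
        simple   : Injective _≡_ _≡_ at
        edge     : ∀ i → E (at (inject₁ i)) (at (suc i))
        start    : at zero ≡ u
        end      : at (fromℕ len) ≡ v
        within   : ∀ i → at i ∈ R
    open SimplePath

    trivial-path : ∀ {E R u} → u ∈ R → SimplePath E R u u
    trivial-path {u = u} u∈R = record
      { len = 0 ; at = λ _ → u ; simple = λ { {zero} {zero} _ → refl } ; edge = λ () ; start = refl ; end = refl ; within = λ _ → u∈R }

    cons-path : ∀ {E E′ R u v w} → (∀ {a b} → E a b → E′ a b) → w ∉ R → E′ w u → SimplePath E R u v → SimplePath E′ (w ∷ R) w v
    cons-path {E} {E′} {R} {u} {v} {w} weaken w∉R wu p = record
      { len = suc (len p) ; at = at′ ; simple = simple′ ; edge = edge′ ; start = refl ; end = end p ; within = within′ }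
      where
      at′ : Fin (2 + len p) → V
      at′ zero    = w
      at′ (suc i) = at p i
      simple′ : Injective _≡_ _≡_ at′
      simple′ {zero}  {zero}  _ = refl
      simple′ {zero}  {suc j} e = contradiction (subst (_∈ R) (sym e) (within p j)) w∉R
      simple′ {suc i} {zero}  e = contradiction (subst (_∈ R) e (within p i)) w∉R
      simple′ {suc i} {suc j} e = cong suc (simple p e)
      edge′ : ∀ i → E′ (at′ (inject₁ i)) (at′ (suc i))
      edge′ zero    = subst (E′ w) (sym (start p)) wu
      edge′ (suc i) = weaken (edge p i)
      within′ : ∀ i → at′ i ∈ w ∷ R
      within′ zero    = here refl
      within′ (suc i) = there (within p i)

    weaken-path : ∀ {E E′ R u v w} → (∀ {a b} → E a b → E′ a b) → SimplePath E R u v → SimplePath E′ (w ∷ R) u v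
    weaken-path weaken p = record
      { len = len p ; at = at p ; simple = simple p ; edge = weaken ∘ edge p ; start = start p ; end = end p ; within = there ∘ within p }

    reverse-path : ∀ {E R u v} → (∀ {a b} → E a b → E b a) → SimplePath E R u v → SimplePath E R v u
    reverse-path {E} E-sym p = record
      { len = len p
      ; at = at p ∘ opposite
      ; simple = λ {i} {j} e → trans (sym (F.opposite-involutive i)) (trans (cong opposite (simple p e)) (F.opposite-involutive j))
      ; edge = λ i → E-sym (subst₂ (λ a b → E (at p a) (at p b)) (inject₁-opposite i) (sym (opposite-inject₁ i)) (edge p (opposite i)))
      ; start = end p
      ; end = trans (cong (at p) (opposite-fromℕ (len p))) (start p)
      ; within = within p ∘ opposite
      }
      where
      inject₁-opposite : ∀ {m} (i : Fin m) → inject₁ (opposite i) ≡ opposite (suc i)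
      inject₁-opposite i = F.toℕ-injective (trans (F.toℕ-inject₁ (opposite i)) (sym (F.opposite-suc i)))
      opposite-inject₁ : ∀ {m} (i : Fin m) → opposite (inject₁ i) ≡ suc (opposite i)
      opposite-inject₁ zero    = refl
      opposite-inject₁ (suc i) = cong inject₁ (opposite-inject₁ i)
      opposite-fromℕ : ∀ m → opposite (fromℕ m) ≡ zero
      opposite-fromℕ zero    = refl
      opposite-fromℕ (suc m) = cong inject₁ (opposite-fromℕ m)

    tree-path : ∀ {R} (t : Tree G R) {u v} → u ∈ R → v ∈ R → SimplePath (TreeEdge G t) R u v
    tree-path (root r) (here refl) (here refl) = trivial-path (here refl)
    tree-path (grow t w∉R r∈R e) (here refl)  (here refl)  = trivial-path (here refl)
    tree-path (grow t w∉R r∈R e) (here refl)  (there v∈R) = cons-path inj₂ w∉R (inj₁ (inj₁ (refl , refl))) (tree-path t r∈R v∈R)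
    tree-path (grow t w∉R r∈R e) (there u∈R) (here refl)  =
      reverse-path (TreeEdge-sym G (grow t w∉R r∈R e)) (cons-path inj₂ w∉R (inj₁ (inj₁ (refl , refl))) (tree-path t r∈R u∈R))
    tree-path (grow t w∉R r∈R e) (there u∈R) (there v∈R) = weaken-path inj₂ (tree-path t u∈R v∈R)

    -- A path of length 0 would make xy a loop and one of length 1 would put xy into E, so the
    -- closed path has at least three vertices.
    close-path : ∀ {E : V → V → Set} {R x y} → (∀ {a b} → E a b → Adj G a b) → Adj G x y → ¬ E x y → (p : SimplePath E R x y) →
      Σ (Cycle G) λ c → cycLength c ≡ suc (len p) × CycEdge c x y × (∀ {u v} → CycEdge c u v → E u v ⊎ E v u ⊎ SameEdge u v x y)
    close-path {E} {R} {x} {y} E⇒Adj xy ¬Exy p = c , refl , inj₂ (inj₂ (end p , start p)) , edges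
      where
      long′ : ∀ m (f : Fin (suc m) → V) → (∀ i → E (f (inject₁ i)) (f (suc i))) → f zero ≡ x → f (fromℕ m) ≡ y → 2 ≤ m
      long′ 0 f h refl refl             = contradiction xy (Adj-irrefl G)
      long′ 1 f h refl refl             = contradiction (h zero) ¬Exy
      long′ (suc (suc m)) f h refl refl = s≤s (s≤s z≤n)
      c : Cycle G
      c = record
        { m' = len p ; long = long′ (len p) (at p) (edge p) (start p) (end p) ; vs = at p ; inj = simple p ; path = E⇒Adj ∘ edge p
        ; closing = subst₂ (Adj G) (sym (end p)) (sym (start p)) (Adj-sym G xy) }
      edges : ∀ {u v} → CycEdge c u v → E u v ⊎ E v u ⊎ SameEdge u v x y
      edges (inj₁ (i , inj₁ (refl , refl))) = inj₁ (edge p i)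
      edges (inj₁ (i , inj₂ (refl , refl))) = inj₂ (inj₁ (edge p i))
      edges (inj₂ (inj₁ (refl , refl)))     = inj₂ (inj₂ (inj₂ (end p , start p)))
      edges (inj₂ (inj₂ (refl , refl)))     = inj₂ (inj₂ (inj₁ (start p , end p)))

    path-alternates : ∀ {E : V → V → Set} {R u v} (s : V → Bool) → (∀ {a b} → E a b → s a ≡ not (s b)) → (p : SimplePath E R u v) → s u ≡ not^ (len p) (s v)
    path-alternates {E} s alternates p = subst₂ (λ a b → s a ≡ not^ (len p) (s b)) (start p) (end p) (go (len p) (at p) (edge p))
      where
      go : ∀ m (f : Fin (suc m) → V) → (∀ i → E (f (inject₁ i)) (f (suc i))) → s (f zero) ≡ not^ m (s (f (fromℕ m)))
      go zero    f h = refl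
      go (suc m) f h = trans (alternates (h zero)) (cong not (go m (f ∘ suc) (h ∘ suc)))

    module _ (no-odd : NoOddCycle G) (one-even : AtMostOneEvenCycle G) {R} (t : Tree G R) (all : ∀ v → v ∈ R) where

      even : ∀ c → EvenCycle c
      even c = decidable-stable (2 ∣? cycLength c) (no-odd c)

      -- A non-tree edge closes a tree path to a cycle on which it is the only non-tree edge. All
      -- cycles are even and have the same edges, so a second non-tree edge would lie on the cycle
      -- of xy.
      non-tree-unique : ∀ {x y} → Adj G x y → ¬ TreeEdge G t x y → ∀ {u v} → Adj G u v → TreeEdge G t u v ⊎ SameEdge u v x y
      non-tree-unique {x} {y} xy ¬xy {u} {v} uv with TreeEdge? G t u v
      ... | yes e = inj₁ e
      ... | no ¬uv with close-path (TreeEdge⇒Adj G t) xy ¬xy (tree-path t (all x) (all y)) | close-path (TreeEdge⇒Adj G t) uv ¬uv (tree-path t (all u) (all v))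
      ...   | c , _ , _ , edges | d , _ , uv∈d , _ with edges (proj₂ (one-even c d (even c) (even d) u v) uv∈d)
      ...     | inj₁ e           = inj₁ e
      ...     | inj₂ (inj₁ e)    = inj₁ (TreeEdge-sym G t e)
      ...     | inj₂ (inj₂ same) = inj₂ same

      -- The cycle closed by xy is even, so the tree path from x to y is odd, and sides alternate
      -- along it.
      non-tree-crosses : ∀ {x y} → Adj G x y → ¬ TreeEdge G t x y → side G t x ≡ not (side G t y)
      non-tree-crosses {x} {y} xy ¬xy with close-path (TreeEdge⇒Adj G t) xy ¬xy (tree-path t (all x) (all y)) | not^-parity (len (tree-path t (all x) (all y)))
      ... | _           | inj₂ (_ , odd) = trans (path-alternates (side G t) (side-edge G t) (tree-path t (all x) (all y))) (odd (side G t y))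
      ... | c , e , _ | inj₁ (2∣len , _) = contradiction (∣m+n∣m⇒∣n (subst (2 ∣_) (trans e (+-comm 1 _)) (even c)) 2∣len) λ { (divides (suc _) ()) }

      colour-along-tree : ∀ {x y} → (∀ {u v} → Adj G u v → TreeEdge G t u v ⊎ SameEdge u v x y) → (Adj G x y → side G t x ≡ true × side G t y ≡ false) →
        ∀ j (H : Cover G (suc (j + j))) → Σ (V → Subset (suc (j + j))) λ S → QuasiIndependent H S × (∀ u → j ≤ ∣ S u ∣)
      colour-along-tree spans crosses j H = near-half-colouring G H (gauge G H t) (side G t)
        (λ {u} {v} {i} {i′} e → Sum.map₁ (λ tree → gauge-edge G H t tree i i′ e , side-edge G t tree) (spans (crossAdj H u v i i′ e)))
        (λ {i} {i′} e → crosses (crossAdj H _ _ i i′ e))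

    near-half-colourable : Connected G → NoOddCycle G → AtMostOneEvenCycle G →
      ∀ j (H : Cover G (suc (j + j))) → Σ (V → Subset (suc (j + j))) λ S → QuasiIndependent H S × (∀ u → j ≤ ∣ S u ∣)
    near-half-colourable conn no-odd one-even with spanning-tree conn
    ... | R , t , all with F.any? (λ x → F.any? λ y → (adj G x y B.≟ true) ×-dec ¬? (TreeEdge? G t x y))
    -- When the graph is a tree, the pair (r, r) stands in for the exceptional edge; since there are
    -- no loops, its condition holds vacuously.
    ...   | no none = colour-along-tree no-odd one-even t all {x = r} {y = r} (λ {u} {v} uv → inj₁ (decidable-stable (TreeEdge? G t u v) λ ¬uv → none (u , v , uv , ¬uv)))
                        (λ rr → contradiction rr (Adj-irrefl G))
      where
      r : V
      r = F.fromℕ< (>-nonZero⁻¹ (order G) {{proj₁ conn}})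
    ...   | yes (x , y , xy , ¬xy) = oriented (side G t x) (side G t y) refl refl (non-tree-crosses no-odd one-even t all xy ¬xy)
      where
      spans = non-tree-unique no-odd one-even t all xy ¬xy
      -- The exceptional edge must start on the side `true`, where A is used and to which ρ is
      -- applied; otherwise its ends are swapped.
      oriented : ∀ a b → side G t x ≡ a → side G t y ≡ b → side G t x ≡ not (side G t y) → ∀ j (H : Cover G (suc (j + j))) → _
      oriented true  false p q _ = colour-along-tree no-odd one-even t all spans (λ _ → p , q)
      oriented false true  p q _ = colour-along-tree no-odd one-even t all (Sum.map₂ SameEdge-flip ∘ spans) (λ _ → q , p)
      oriented true  true  p q e = contradiction (trans (sym p) (trans e (cong not q))) λ ()
      oriented false false p q e = contradiction (trans (sym p) (trans e (cong not q))) λ ()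

-- From rational fractions to integer deficiencies

open Mixing
open Labellings
open Cycles
open Trees
open import Data.Fin.Subset.Properties using (∣⊤∣≡n; ∣p∣≤n)
open import Data.Integer as ℤ using (+_; -[1+_])
import Data.Integer.Properties as ℤ
open import Data.Nat as ℕ using (ℕ; zero; suc; NonZero; s≤s; z≤n)
import Data.Nat.DivMod as ℕ
import Data.Nat.Properties as ℕ
open import Data.Rational using (ℚ; mkℚ; _≤_; _<_; _*_; _+_; 0ℚ; 1ℚ; _/_; toℚᵘ; positive; nonNegative; Positive; NonNegative)
open import Data.Rational.Properties
import Data.Rational.Solver as ℚ-Solver
open import Data.Rational.Unnormalised as ℚᵘ using (mkℚᵘ; *≡*; *≤*; *<*)
import Data.Rational.Unnormalised.Properties as ℚᵘ

toℚᵘ-ℕ→ℚ : ∀ m → toℚᵘ (ℕ→ℚ m) ℚᵘ.≃ mkℚᵘ (+ m) 0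
toℚᵘ-ℕ→ℚ m = toℚᵘ-fromℚᵘ (mkℚᵘ (+ m) 0)

ℕ→ℚ-+ : ∀ m n → ℕ→ℚ (m ℕ.+ n) ≡ ℕ→ℚ m + ℕ→ℚ n
ℕ→ℚ-+ m n = toℚᵘ-injective (begin
  toℚᵘ (ℕ→ℚ (m ℕ.+ n))                       ≈⟨ toℚᵘ-ℕ→ℚ (m ℕ.+ n) ⟩
  mkℚᵘ (+ (m ℕ.+ n)) 0                       ≈⟨ *≡* (cong (ℤ._* + 1) (cong₂ ℤ._+_ (sym (ℤ.*-identityʳ (+ m))) (sym (ℤ.*-identityʳ (+ n))))) ⟩
  mkℚᵘ (+ m) 0 ℚᵘ.+ mkℚᵘ (+ n) 0             ≈⟨ ℚᵘ.+-cong (toℚᵘ-ℕ→ℚ m) (toℚᵘ-ℕ→ℚ n) ⟨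
  toℚᵘ (ℕ→ℚ m) ℚᵘ.+ toℚᵘ (ℕ→ℚ n)             ≈⟨ toℚᵘ-homo-+ (ℕ→ℚ m) (ℕ→ℚ n) ⟨
  toℚᵘ (ℕ→ℚ m + ℕ→ℚ n)                       ∎)
  where open import Relation.Binary.Reasoning.Setoid ℚᵘ.≃-setoid

ℕ→ℚ-* : ∀ m n → ℕ→ℚ (m ℕ.* n) ≡ ℕ→ℚ m * ℕ→ℚ n
ℕ→ℚ-* m n = toℚᵘ-injective (begin
  toℚᵘ (ℕ→ℚ (m ℕ.* n))                       ≈⟨ toℚᵘ-ℕ→ℚ (m ℕ.* n) ⟩
  mkℚᵘ (+ (m ℕ.* n)) 0                       ≈⟨ *≡* (cong (ℤ._* + 1) (ℤ.pos-* m n)) ⟩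
  mkℚᵘ (+ m) 0 ℚᵘ.* mkℚᵘ (+ n) 0             ≈⟨ ℚᵘ.*-cong (toℚᵘ-ℕ→ℚ m) (toℚᵘ-ℕ→ℚ n) ⟨
  toℚᵘ (ℕ→ℚ m) ℚᵘ.* toℚᵘ (ℕ→ℚ n)             ≈⟨ toℚᵘ-homo-* (ℕ→ℚ m) (ℕ→ℚ n) ⟨
  toℚᵘ (ℕ→ℚ m * ℕ→ℚ n)                       ∎)
  where open import Relation.Binary.Reasoning.Setoid ℚᵘ.≃-setoid

ℕ→ℚ-mono-≤ : ∀ {m n} → m ℕ.≤ n → ℕ→ℚ m ≤ ℕ→ℚ n
ℕ→ℚ-mono-≤ {m} {n} h = toℚᵘ-cancel-≤ (ℚᵘ.≤-respˡ-≃ (ℚᵘ.≃-sym (toℚᵘ-ℕ→ℚ m)) (ℚᵘ.≤-respʳ-≃ (ℚᵘ.≃-sym (toℚᵘ-ℕ→ℚ n))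
  (*≤* (ℤ.*-monoʳ-≤-nonNeg (+ 1) (ℤ.+≤+ h)))))

ℕ→ℚ-mono-< : ∀ {m n} → m ℕ.< n → ℕ→ℚ m < ℕ→ℚ n
ℕ→ℚ-mono-< {m} {n} h = toℚᵘ-cancel-< (ℚᵘ.<-respˡ-≃ (ℚᵘ.≃-sym (toℚᵘ-ℕ→ℚ m)) (ℚᵘ.<-respʳ-≃ (ℚᵘ.≃-sym (toℚᵘ-ℕ→ℚ n))
  (*<* (ℤ.*-monoʳ-<-pos (+ 1) (ℤ.+<+ h)))))

ℕ→ℚ-cancel-≤ : ∀ m n → ℕ→ℚ m ≤ ℕ→ℚ n → m ℕ.≤ n
ℕ→ℚ-cancel-≤ m n h = ℕ.≮⇒≥ λ n<m → <-irrefl refl (<-≤-trans (ℕ→ℚ-mono-< {n} {m} n<m) h)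

ℕ→ℚ-pos : ∀ m → Positive (ℕ→ℚ (suc m))
ℕ→ℚ-pos m = positive {ℕ→ℚ (suc m)} (ℕ→ℚ-mono-< {0} {suc m} (s≤s z≤n))

ℕ→ℚ-nonNeg : ∀ m → NonNegative (ℕ→ℚ m)
ℕ→ℚ-nonNeg m = nonNegative {ℕ→ℚ m} (ℕ→ℚ-mono-≤ {0} {m} z≤n)

/*ℕ→ℚ : ∀ m d → (+ m / suc d) * ℕ→ℚ (suc d) ≡ ℕ→ℚ m
/*ℕ→ℚ m d = toℚᵘ-injective (begin
  toℚᵘ ((+ m / suc d) * ℕ→ℚ (suc d))              ≈⟨ toℚᵘ-homo-* (+ m / suc d) (ℕ→ℚ (suc d)) ⟩
  toℚᵘ (+ m / suc d) ℚᵘ.* toℚᵘ (ℕ→ℚ (suc d))      ≈⟨ ℚᵘ.*-cong (toℚᵘ-fromℚᵘ (mkℚᵘ (+ m) d)) (toℚᵘ-ℕ→ℚ (suc d)) ⟩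
  mkℚᵘ (+ m) d ℚᵘ.* mkℚᵘ (+ suc d) 0              ≈⟨ *≡* (ℤ.*-assoc (+ m) (+ suc d) (+ 1)) ⟩
  mkℚᵘ (+ m) 0                                    ≈⟨ toℚᵘ-ℕ→ℚ m ⟨
  toℚᵘ (ℕ→ℚ m)                                    ∎)
  where open import Relation.Binary.Reasoning.Setoid ℚᵘ.≃-setoid

archimedean : ∀ ε → 0ℚ < ε → ∃ λ j → 1ℚ < ε * ℕ→ℚ j
archimedean (mkℚ -[1+ n ] d c) ε>0 = contradiction (positive ε>0) λ ()
archimedean (mkℚ (+ zero) d c) ε>0 = contradiction (positive ε>0) λ ()
-- Multiplying ε by its denominator gives `suc n`, which may be 1; the factor 2 makes the inequality
-- strict.
archimedean ε@(mkℚ (+ suc n) d c) ε>0 = suc d ℕ.* 2 , (begin-strict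
  1ℚ                           <⟨ ℕ→ℚ-mono-< {1} {suc n ℕ.* 2} (s≤s (s≤s z≤n)) ⟩
  ℕ→ℚ (suc n ℕ.* 2)            ≡⟨ ℕ→ℚ-* (suc n) 2 ⟩
  ℕ→ℚ (suc n) * two            ≡⟨ cong (_* two) (trans (cong (_* ℕ→ℚ (suc d)) (sym (fromℚᵘ-toℚᵘ ε))) (/*ℕ→ℚ (suc n) d)) ⟨
  ε * ℕ→ℚ (suc d) * two        ≡⟨ *-assoc ε (ℕ→ℚ (suc d)) two ⟩
  ε * (ℕ→ℚ (suc d) * two)      ≡⟨ cong (ε *_) (ℕ→ℚ-* (suc d) 2) ⟨
  ε * ℕ→ℚ (suc d ℕ.* 2)        ∎)
  where open ≤-Reasoning

module _ {G : Graph} {k : ℕ} where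

  open ≤-Reasoning

  scale-≤ : ∀ r θ s → NonNegative r → 1ℚ ≤ r * θ → θ * ℕ→ℚ k ≤ ℕ→ℚ s → ℕ→ℚ k ≤ r * ℕ→ℚ s
  scale-≤ r θ s r≥0 h h′ = begin
    ℕ→ℚ k               ≡⟨ *-identityˡ (ℕ→ℚ k) ⟨
    1ℚ * ℕ→ℚ k          ≤⟨ *-monoʳ-≤-nonNeg (ℕ→ℚ k) {{ℕ→ℚ-nonNeg k}} h ⟩
    r * θ * ℕ→ℚ k       ≡⟨ *-assoc r θ (ℕ→ℚ k) ⟩
    r * (θ * ℕ→ℚ k)     ≤⟨ *-monoˡ-≤-nonNeg r {{r≥0}} h′ ⟩
    r * ℕ→ℚ s           ∎

  half⇒colourable : ∀ θ → AdmitsAll G k θ → 1ℚ ≤ two * θ → Colourable G k 0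
  half⇒colourable θ adm h H with adm H
  ... | S , independent , large = S , independent , λ u → subst (k ℕ.≤_) (sym (ℕ.+-identityʳ _))
    (ℕ→ℚ-cancel-≤ k (2 ℕ.* ∣ S u ∣) (subst (ℕ→ℚ k ≤_) (sym (ℕ→ℚ-* 2 ∣ S u ∣)) (scale-≤ two θ ∣ S u ∣ (ℕ→ℚ-nonNeg 2) h (large u))))

  -- Multiplying by D clears ε and gives kD ≤ 2sD + s. Since s ≤ k, the shortfall of 2s below k,
  -- times D, is at most k; being an integer, it is at most the rounded quotient.
  near-half⇒colourable : ∀ θ ε D .{{_ : NonZero D}} → 0ℚ ≤ ε → ε * ℕ→ℚ D ≡ 1ℚ → AdmitsAll G k θ → 1ℚ ≤ (two + ε) * θ → Colourable G k (k ℕ./ D)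
  near-half⇒colourable θ ε D ε≥0 εD≡1 adm h H with adm H
  ... | S , independent , large = S , independent , λ u → deficiency ∣ S u ∣ (∣p∣≤n (S u)) (large u)
    where
    deficiency : ∀ s → s ℕ.≤ k → θ * ℕ→ℚ k ≤ ℕ→ℚ s → k ℕ.≤ 2 ℕ.* s ℕ.+ k ℕ./ D
    deficiency s s≤k θk≤s = ℕ.≤-trans (ℕ.m≤n+m∸n k (2 ℕ.* s)) (ℕ.+-monoʳ-≤ (2 ℕ.* s)
      (subst (ℕ._≤ k ℕ./ D) (ℕ.m*n/n≡m (k ℕ.∸ 2 ℕ.* s) D) (ℕ./-monoˡ-≤ D (ℕ.≤-trans
        (ℕ.≤-trans (ℕ.≤-reflexive (ℕ.*-distribʳ-∸ D k (2 ℕ.* s))) (ℕ.m≤n+o⇒m∸n≤o (k ℕ.* D) (2 ℕ.* s ℕ.* D) kD≤)) s≤k))))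
      where
      kD≤ : k ℕ.* D ℕ.≤ 2 ℕ.* s ℕ.* D ℕ.+ s
      kD≤ = ℕ→ℚ-cancel-≤ (k ℕ.* D) (2 ℕ.* s ℕ.* D ℕ.+ s) (begin
        ℕ→ℚ (k ℕ.* D)                             ≡⟨ ℕ→ℚ-* k D ⟩
        ℕ→ℚ k * ℕ→ℚ D                             ≤⟨ *-monoʳ-≤-nonNeg (ℕ→ℚ D) {{ℕ→ℚ-nonNeg D}} (scale-≤ (two + ε) θ s two+ε≥0 h θk≤s) ⟩
        (two + ε) * ℕ→ℚ s * ℕ→ℚ D                 ≡⟨ expand two ε (ℕ→ℚ s) (ℕ→ℚ D) ⟩
        two * ℕ→ℚ s * ℕ→ℚ D + ε * ℕ→ℚ D * ℕ→ℚ s   ≡⟨ cong₂ _+_ (trans (cong (_* ℕ→ℚ D) (sym (ℕ→ℚ-* 2 s))) (sym (ℕ→ℚ-* (2 ℕ.* s) D))) (trans (cong (_* ℕ→ℚ s) εD≡1) (*-identityˡ (ℕ→ℚ s))) ⟩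
        ℕ→ℚ (2 ℕ.* s ℕ.* D) + ℕ→ℚ s               ≡⟨ ℕ→ℚ-+ (2 ℕ.* s ℕ.* D) s ⟨
        ℕ→ℚ (2 ℕ.* s ℕ.* D ℕ.+ s)                 ∎)
        where
        two+ε≥0 : NonNegative (two + ε)
        two+ε≥0 = nonNegative {two + ε} (+-mono-≤ {0ℚ} {two} {0ℚ} {ε} (ℕ→ℚ-mono-≤ {0} {2} z≤n) ε≥0)
        expand : ∀ t e s D → (t + e) * s * D ≡ t * s * D + e * D * s
        expand t e s D = solve 4 (λ t e s D → (t :+ e) :* s :* D := t :* s :* D :+ e :* D :* s) refl t e s D
          where open ℚ-Solver.+-*-Solver

-- Bounds on θ and the fractional DP-chromatic number

module _ (G : Graph) where

  DeficiencyBound : Set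
  DeficiencyBound = ∃ λ L → ∀ k δ → Colourable G (suc k) δ → suc k ℕ.≤ L ℕ.* δ

  1/[1+L]>0 : ∀ L → 0ℚ < + 1 / suc L
  1/[1+L]>0 L = *-cancelʳ-<-nonNeg (ℕ→ℚ (suc L)) {{ℕ→ℚ-nonNeg (suc L)}} (begin-strict
      0ℚ * ℕ→ℚ (suc L)             ≡⟨ *-zeroˡ (ℕ→ℚ (suc L)) ⟩
      0ℚ                           <⟨ ℕ→ℚ-mono-< {0} {1} (s≤s z≤n) ⟩
      1ℚ                           ≡⟨ /*ℕ→ℚ 1 L ⟨
      (+ 1 / suc L) * ℕ→ℚ (suc L)  ∎)
    where open ≤-Reasoning

  -- With ε = 1 / (L + 1) the deficiency satisfies (L + 1) δ ≤ `suc k` ≤ L δ. So δ = 0, and the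
  -- bound becomes `suc k` ≤ 0.
  deficiency-bound⇒¬near-half : ((L , _) : DeficiencyBound) → ∀ ε → 0ℚ < ε → ε * ℕ→ℚ (suc L) ≡ 1ℚ →
    ∀ k θ → AdmitsAll G (suc k) θ → ¬ 1ℚ < (two + ε) * θ
  deficiency-bound⇒¬near-half (L , bound) ε ε>0 ε[1+L]≡1 k θ adm h = ℕ.n≮0 (ℕ.≤-trans k≤ (ℕ.≤-reflexive (trans (cong (L ℕ.*_) (ℕ.n≤0⇒n≡0 δ≤0)) (ℕ.*-zeroʳ L))))
    where
    open ℕ.≤-Reasoning
    δ = suc k ℕ./ suc L
    k≤ : suc k ℕ.≤ L ℕ.* δ
    k≤ = bound k δ (near-half⇒colourable θ ε (suc L) (<⇒≤ ε>0) ε[1+L]≡1 adm (<⇒≤ h))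
    δ≤0 : δ ℕ.≤ 0
    δ≤0 = ℕ.+-cancelʳ-≤ (L ℕ.* δ) δ 0 (begin
      suc L ℕ.* δ     ≡⟨ ℕ.*-comm (suc L) δ ⟩
      δ ℕ.* suc L     ≤⟨ ℕ.m/n*n≤m (suc k) (suc L) ⟩
      suc k           ≤⟨ k≤ ⟩
      L ℕ.* δ         ∎)

  deficiency-bound⇒¬ChiDP≤ : DeficiencyBound → ¬ ChiDP≤ G two
  deficiency-bound⇒¬ChiDP≤ (L , bound) chi = refute (chi (+ 1 / suc L) (1/[1+L]>0 L))
    where
    refute : (Σ ℕ λ k → NonZero k × Σ ℚ λ θ → IsThetaDP G k θ × 0ℚ < θ × 1ℚ < (two + + 1 / suc L) * θ) → ⊥
    refute (suc k , _ , θ , (_ , _ , adm , _) , _ , h) = deficiency-bound⇒¬near-half (L , bound) (+ 1 / suc L) (1/[1+L]>0 L) (/*ℕ→ℚ 1 L) k θ adm h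

  ChiDP≤⇒NoOddCycle : ChiDP≤ G two → NoOddCycle G
  ChiDP≤⇒NoOddCycle chi c odd = deficiency-bound⇒¬ChiDP≤ (cycLength c , λ k δ → odd-cycle-deficiency c odd) chi

  ChiDP≤⇒AtMostOneEvenCycle : Connected G → ChiDP≤ G two → AtMostOneEvenCycle G
  ChiDP≤⇒AtMostOneEvenCycle conn chi c d _ _ u v = ⊆ c d , ⊆ d c
    where
    ⊆ : ∀ c d → CycEdge c u v → CycEdge d u v
    ⊆ c d uv∈c = decidable-stable (CycEdge? d u v) λ uv∉d → deficiency-bound⇒¬ChiDP≤ (distinct-cycles-deficiency conn c d uv∈c uv∉d) chi

  cycle⇒ThetaInv> : Cycle G → ∀ k → NonZero k → ThetaInv> G k two
  cycle⇒ThetaInv> c (suc k) _ θ (_ , _ , adm , _) = ≰⇒> λ h → cycle⇒¬exactly-half c (half⇒colourable θ adm h)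

  theta-edgeless : (∀ u v → ¬ Adj G u v) → ∀ k → IsThetaDP G k 1ℚ
  theta-edgeless none k = ℕ→ℚ-mono-≤ {0} {1} z≤n , ≤-refl , (λ H → (λ _ → ⊤) , (λ u v i j e _ _ → none u v (crossAdj H u v i j e))
    , λ u → ≤-reflexive (trans (*-identityˡ (ℕ→ℚ k)) (cong ℕ→ℚ (sym (∣⊤∣≡n k))))) , λ η _ η≤1 _ → η≤1

  -- `ChiDP≤` asks for the exact maximum. The edge uv supplies the upper bound: under identity
  -- labels S u and S v are disjoint among 2j + 1 points, so one of them has at most j. An edgeless
  -- graph has maximum 1 and is treated apart.
  theta-near-half : ∀ {u v} → Adj G u v → ∀ j θ → θ * ℕ→ℚ (suc (j ℕ.+ j)) ≡ ℕ→ℚ j →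
    ((H : Cover G (suc (j ℕ.+ j))) → Σ _ λ S → QuasiIndependent H S × (∀ u → j ℕ.≤ ∣ S u ∣)) →
    IsThetaDP G (suc (j ℕ.+ j)) θ
  theta-near-half {u} {v} uv j θ θk≡j colour = θ≥0 , θ≤1 , admits , maximal
    where
    open ≤-Reasoning
    k = suc (j ℕ.+ j)
    cancel : ∀ p q → p * ℕ→ℚ k ≤ q * ℕ→ℚ k → p ≤ q
    cancel p q = *-cancelʳ-≤-pos {p} {q} (ℕ→ℚ k) {{ℕ→ℚ-pos (j ℕ.+ j)}}
    θ≥0 : 0ℚ ≤ θ
    θ≥0 = cancel 0ℚ θ (begin
      0ℚ * ℕ→ℚ k   ≡⟨ *-zeroˡ (ℕ→ℚ k) ⟩
      0ℚ           ≤⟨ ℕ→ℚ-mono-≤ {0} {j} z≤n ⟩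
      ℕ→ℚ j        ≡⟨ θk≡j ⟨
      θ * ℕ→ℚ k    ∎)
    θ≤1 : θ ≤ 1ℚ
    θ≤1 = cancel θ 1ℚ (begin
      θ * ℕ→ℚ k    ≡⟨ θk≡j ⟩
      ℕ→ℚ j        ≤⟨ ℕ→ℚ-mono-≤ {j} {k} (ℕ.m≤n⇒m≤1+n (ℕ.m≤m+n j j)) ⟩
      ℕ→ℚ k        ≡⟨ *-identityˡ (ℕ→ℚ k) ⟨
      1ℚ * ℕ→ℚ k   ∎)
    admits : AdmitsAll G k θ
    admits H with colour H
    ... | S , independent , large = S , independent , λ u → ≤-trans (≤-reflexive θk≡j) (ℕ→ℚ-mono-≤ {j} {∣ S u ∣} (large u))
    maximal : ∀ η → 0ℚ ≤ η → η ≤ 1ℚ → AdmitsAll G k η → η ≤ θ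
    maximal η _ _ adm with adm (labelledCover G (identityLabelling G))
    ... | S , independent , large = cancel η θ (≤-trans small (≤-reflexive (sym θk≡j)))
      where
      sizes : ∣ S u ∣ ℕ.+ ∣ S v ∣ ℕ.≤ k
      sizes = subst₂ (λ a b → a ℕ.+ b ℕ.≤ k) (sym (∣∣≡size (S u))) (sym (∣∣≡size (S v)))
        (ℕ.≤-trans (ℕ.m≤n+m (size (lookup (S u)) ℕ.+ size (lookup (S v))) (distance (lookup (S u)) (not ∘ lookup (S v)))) (ℕ.≤-reflexive (size-disjoint (disjoint-labelled G (identityLabelling G) S independent uv))))
      small : η * ℕ→ℚ k ≤ ℕ→ℚ j
      small with ∣ S u ∣ ℕ.≤? j | ∣ S v ∣ ℕ.≤? j
      ... | yes p | _     = ≤-trans (large u) (ℕ→ℚ-mono-≤ {∣ S u ∣} {j} p)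
      ... | no _  | yes p = ≤-trans (large v) (ℕ→ℚ-mono-≤ {∣ S v ∣} {j} p)
      ... | no p  | no q  = contradiction sizes (ℕ.<⇒≱ (subst (ℕ._≤ ∣ S u ∣ ℕ.+ ∣ S v ∣) (cong suc (ℕ.+-suc j j)) (ℕ.+-mono-≤ (ℕ.≰⇒> p) (ℕ.≰⇒> q))))

  -- Multiplied by k = 2j + 1, the second claim reads 2j + 1 < 2j + εj, which is the assumption on
  -- j.
  near-half-theta : ∀ ε → 0ℚ < ε → ∀ j θ → θ * ℕ→ℚ (suc (j ℕ.+ j)) ≡ ℕ→ℚ j → 1ℚ < ε * ℕ→ℚ j → 0ℚ < θ × 1ℚ < (two + ε) * θ
  near-half-theta ε ε>0 j θ θk≡j εj>1 = θ>0 j refl , near-half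
    where
    open ≤-Reasoning
    k = suc (j ℕ.+ j)
    cancel : ∀ p q → p * ℕ→ℚ k < q * ℕ→ℚ k → p < q
    cancel p q = *-cancelʳ-<-nonNeg (ℕ→ℚ k) {{ℕ→ℚ-nonNeg k}} {p} {q}
    θ>0 : ∀ i → i ≡ j → 0ℚ < θ
    θ>0 zero    e = contradiction εj>1 (<-asym (subst (_< 1ℚ) (sym (trans (cong (λ i → ε * ℕ→ℚ i) (sym e)) (*-zeroʳ ε))) (ℕ→ℚ-mono-< {0} {1} (s≤s z≤n))))
    θ>0 (suc i) e = cancel 0ℚ θ (begin-strict
      0ℚ * ℕ→ℚ k   ≡⟨ *-zeroˡ (ℕ→ℚ k) ⟩
      0ℚ           <⟨ ℕ→ℚ-mono-< {0} {suc i} (s≤s z≤n) ⟩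
      ℕ→ℚ (suc i)  ≡⟨ cong ℕ→ℚ e ⟩
      ℕ→ℚ j        ≡⟨ θk≡j ⟨
      θ * ℕ→ℚ k    ∎)
    near-half : 1ℚ < (two + ε) * θ
    near-half = cancel 1ℚ ((two + ε) * θ) (begin-strict
      1ℚ * ℕ→ℚ k                    ≡⟨ trans (*-identityˡ (ℕ→ℚ k)) (trans (ℕ→ℚ-+ 1 (j ℕ.+ j)) (cong (λ x → 1ℚ + ℕ→ℚ (j ℕ.+ x)) (sym (ℕ.+-identityʳ j)))) ⟩
      1ℚ + ℕ→ℚ (2 ℕ.* j)            ≡⟨ cong (λ x → 1ℚ + x) (ℕ→ℚ-* 2 j) ⟩
      1ℚ + two * ℕ→ℚ j              <⟨ +-monoˡ-< (two * ℕ→ℚ j) εj>1 ⟩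
      ε * ℕ→ℚ j + two * ℕ→ℚ j       ≡⟨ trans (+-comm (ε * ℕ→ℚ j) _) (sym (*-distribʳ-+ (ℕ→ℚ j) two ε)) ⟩
      (two + ε) * ℕ→ℚ j             ≡⟨ cong ((two + ε) *_) θk≡j ⟨
      (two + ε) * (θ * ℕ→ℚ k)       ≡⟨ *-assoc (two + ε) θ (ℕ→ℚ k) ⟨
      (two + ε) * θ * ℕ→ℚ k         ∎)

  edgeless⇒ChiDP≤ : (∀ u v → ¬ Adj G u v) → ChiDP≤ G two
  edgeless⇒ChiDP≤ none ε ε>0 = 1 , _ , 1ℚ , theta-edgeless none 1 , ℕ→ℚ-mono-< {0} {1} (s≤s z≤n) , (begin-strict
    1ℚ               <⟨ ℕ→ℚ-mono-< {1} {2} (s≤s (s≤s z≤n)) ⟩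
    two              ≡⟨ +-identityʳ two ⟨
    two + 0ℚ         <⟨ +-monoʳ-< two ε>0 ⟩
    two + ε          ≡⟨ *-identityʳ (two + ε) ⟨
    (two + ε) * 1ℚ   ∎)
    where open ≤-Reasoning

  unicyclic⇒ChiDP≤ : Connected G → NoOddCycle G → AtMostOneEvenCycle G → ChiDP≤ G two
  unicyclic⇒ChiDP≤ conn no-odd one-even with F.any? (λ u → F.any? λ v → adj G u v B.≟ true)
  ... | no none           = edgeless⇒ChiDP≤ λ u v uv → none (u , v , uv)
  ... | yes (u , v , uv) = λ ε ε>0 →
    let j , εj>1 = archimedean ε ε>0
        θk≡j     = /*ℕ→ℚ j (j ℕ.+ j)
    in suc (j ℕ.+ j) , _ , + j / suc (j ℕ.+ j) , theta-near-half uv j _ θk≡j (near-half-colourable G conn no-odd one-even j)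
     , near-half-theta ε ε>0 j _ θk≡j εj>1

theorem1p5 : (G : Graph) → Connected G →
    (ChiDP≤ G two ⇔ (NoOddCycle G × AtMostOneEvenCycle G))
    × (NoOddCycle G → ExactlyOneEvenCycle G →
    (ChiDP≤ G two × ChiDP≥ G two)
    × ((k : ℕ) → NonZero k → ThetaInv> G k two))
theorem1p5 G conn =
    mk⇔ (λ chi → ChiDP≤⇒NoOddCycle G chi , ChiDP≤⇒AtMostOneEvenCycle G conn chi)
        (λ (no-odd , one-even) → unicyclic⇒ChiDP≤ G conn no-odd one-even)
  , λ no-odd ((c , _) , one-even) →
      (unicyclic⇒ChiDP≤ G conn no-odd one-even , λ k k≢0 θ θ-max → <⇒≤ (cycle⇒ThetaInv> G c k k≢0 θ θ-max))
    , cycle⇒ThetaInv> G c
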